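{- Let $G$ be a finite graph and $x\ne y$ vertices of $G$. Suppose $G$ is the union of subgraphs $H_1,\dots,H_m$ ($m\ge1$) together with an optional subgraph $A_x$ and an optional subgraph $A_y$, where: each $H_j$ is connected and contains $x$ and $y$, with $V(H_j)\cap V(H_l)=\{x,y\}$ for $j\ne l$; $A_x$ (if present) is connected, contains $x$ but not $y$, and meets every $H_j$ only in $x$; $A_y$ (if present) is connected, contains $y$ but not $x$, meets every $H_j$ only in $y$, and is vertex-disjoint from $A_x$; every edge of $G$ other than a possible edge $xy$ lies in exactly one of these subgraphs; and every automorphism of $G$ fixing both $x$ and $y$ maps $A_x$ onto $A_x$, $A_y$ onto $A_y$, and permutes $\{H_1,\dots,H_m\}$. Call $H_j,H_l$ equivalent if there is an isomorphism $H_j\to H_l$ with $x\mapsto x$, $y\mapsto y$; suppose there are $g$ classes, the $i$-th consisting of $m_i$ graphs each isomorphic in this sense to $G_i$. Then for every positive integer $k$, $$D(G,k;x,y)=k^2\,\alpha_x\,\alpha_y\prod_{i=1}^g\binom{D(G_i,k;x,y)/k^2}{m_i},$$ where $\alpha_x=D(A_x,k;x)/k$ if $A_x$ is present and $\alpha_x=1$ otherwise, and similarly for $\alpha_y$.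
   Context: A $k$-labeling of a graph $X$ is a map $\phi:V(X)\to\{1,\dots,k\}$; an automorphism $\pi$ preserves $\phi$ if $\phi(\pi(v))=\phi(v)$ for all $v$. For a subgroup $\Gamma\le\mathrm{Aut}(X)$, $\phi$ is $\Gamma$-distinguishing if the only element of $\Gamma$ preserving $\phi$ is the identity; $\phi,\phi'$ are equivalent with respect to $\Gamma$ if some $\pi\in\Gamma$ satisfies $\phi'(\pi(v))=\phi(v)$ for all $v$; $D(X,k;\Gamma)$ is the number of $\Gamma$-equivalence classes of $\Gamma$-distinguishing $k$-labelings. $\mathrm{Aut}(X;a)$ is the group of automorphisms fixing vertex $a$, and $\mathrm{Aut}(X;x,y)$ the group of automorphisms fixing both $x$ and $y$; $D(X,k;a):=D(X,k;\mathrm{Aut}(X;a))$ and $D(X,k;x,y):=D(X,k;\mathrm{Aut}(X;x,y))$.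
   Formalization: The subgraphs H_1,…,H_m are required to be pairwise distinct, i.e. the single edge xy may not be listed twice; otherwise G=H_1=H_2=K_2 gives D=k² while the formula gives 0. "Union" is read as covering every edge, xy included. -}

module Defs where

open import Data.Bool.Base using (Bool; true; false; T)
open import Data.Bool.Properties using (T-irrelevant) renaming (_≟_ to _≟ᵇ_)
open import Data.Empty using (⊥-elim)
open import Data.Fin.Base using (Fin; zero; suc; finToFun; funToFin)
open import Data.Fin.Properties using (any?; all?; finToFun-funToFin) renaming (_≟_ to _≟ᶠ_)
open import Data.List.Base using (List; length; filter; deduplicate; tabulate; allFin)
open import Data.Maybe.Base using (Maybe; just; nothing) renaming (map to mapMaybe)
open import Data.Maybe.Relation.Unary.All using (All)
open import Data.Maybe.Relation.Unary.Any using (Any)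
open import Data.Nat.Base using (ℕ; zero; suc; _^_; _/_; NonZero)
open import Data.Nat.Properties using (m^n≢0)
open import Data.Product using (Σ; ∃; ∃!; _×_; _,_; proj₁; proj₂)
open import Data.Product.Properties using (Σ-≡,≡→≡)
open import Data.Sum.Base using (_⊎_)
open import Data.Unit.Base using (tt)
open import Function.Base using (_∘_; id)
open import Function.Bundles using (_↔_; _⇔_; mk↔ₛ′; Inverse)
open import Function.Construct.Composition using (_↔-∘_)
open import Function.Construct.Identity using (↔-id)
open import Function.Construct.Symmetry using (↔-sym)
open import Relation.Binary.Construct.Closure.ReflexiveTransitive using (Star)
open import Relation.Binary.Definitions using (DecidableEquality)
open import Relation.Binary.PropositionalEquality using (_≡_; _≢_; _≗_; refl; sym; trans; cong; cong₂; subst)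
open import Relation.Nullary using (¬_; Dec; yes; no)
open import Relation.Nullary.Decidable using (map′; _×-dec_; ¬?; decidable-stable)

open Inverse using (to; from; strictlyInverseˡ; strictlyInverseʳ)

Finite : Set → Set
Finite A = ∃ λ n → A ↔ Fin n

≟-finite : {A : Set} → Finite A → DecidableEquality A
≟-finite (_ , e) a b = map′
  (λ eq → trans (sym (strictlyInverseʳ e a)) (trans (cong (from e) eq) (strictlyInverseʳ e b)))
  (cong (to e))
  (to e a ≟ᶠ to e b)

all-finite? : {A : Set} → Finite A → {P : A → Set} → (∀ a → Dec (P a)) → Dec (∀ a → P a)
all-finite? (_ , e) {P} P? = map′
  (λ h a → subst P (strictlyInverseʳ e a) (h (to e a)))
  (λ h i → h (from e i))
  (all? (P? ∘ from e))

-- Every function A → B is pointwise equal to exactly one function of this form.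

decode : {A B : Set} (F : Finite A) (F′ : Finite B) → Fin (proj₁ F′ ^ proj₁ F) → A → B
decode (_ , e) (_ , f) c a = from f (finToFun c (to e a))

encode : {A B : Set} (F : Finite A) (F′ : Finite B) → (A → B) → Fin (proj₁ F′ ^ proj₁ F)
encode (_ , e) (_ , f) h = funToFin (to f ∘ h ∘ from e)

decode-encode : {A B : Set} (F : Finite A) (F′ : Finite B) (h : A → B) →
                decode F F′ (encode F F′ h) ≗ h
decode-encode (_ , e) (_ , f) h a = trans
  (cong (from f) (finToFun-funToFin (to f ∘ h ∘ from e) (to e a)))
  (trans (strictlyInverseʳ f _) (cong h (strictlyInverseʳ e a)))

anyFunction? : {A B : Set} → Finite A → Finite B → {P : (A → B) → Set} →
               (∀ {h h′} → h ≗ h′ → P h → P h′) → (∀ h → Dec (P h)) → Dec (∃ P)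
anyFunction? F F′ resp P? = map′
  (λ { (c , p) → decode F F′ c , p })
  (λ { (h , p) → encode F F′ h , resp (λ a → sym (decode-encode F F′ h a)) p })
  (any? (P? ∘ decode F F′))

Σ-T-≡ : {A : Set} (p : A → Bool) {a b : A} {s : T (p a)} {t : T (p b)} →
        a ≡ b → _≡_ {A = Σ A (T ∘ p)} (a , s) (b , t)
Σ-T-≡ p eq = Σ-≡,≡→≡ (eq , T-irrelevant _ _)

finite-Fin-subset : ∀ n (p : Fin n → Bool) → Finite (Σ (Fin n) (T ∘ p))
finite-Fin-subset zero p = 0 , mk↔ₛ′ (λ { (() , _) }) (λ ()) (λ ()) (λ { (() , _) })
finite-Fin-subset (suc n) p with p zero in eq | finite-Fin-subset n (p ∘ suc)
... | false | c , e = c , mk↔ₛ′ f g fg gf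
  where
  f : Σ (Fin (suc n)) (T ∘ p) → Fin c
  f (zero , t) = ⊥-elim (subst T eq t)
  f (suc i , t) = to e (i , t)
  g : Fin c → Σ (Fin (suc n)) (T ∘ p)
  g j = suc (proj₁ (from e j)) , proj₂ (from e j)
  fg : ∀ j → f (g j) ≡ j
  fg j = strictlyInverseˡ e j
  gf : ∀ v → g (f v) ≡ v
  gf (zero , t) = ⊥-elim (subst T eq t)
  gf (suc i , t) = Σ-T-≡ p (cong (suc ∘ proj₁) (strictlyInverseʳ e (i , t)))
... | true | c , e = suc c , mk↔ₛ′ f g fg gf
  where
  f : Σ (Fin (suc n)) (T ∘ p) → Fin (suc c)
  f (zero , t) = zero
  f (suc i , t) = suc (to e (i , t))
  g : Fin (suc c) → Σ (Fin (suc n)) (T ∘ p)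
  g zero = zero , subst T (sym eq) tt
  g (suc j) = suc (proj₁ (from e j)) , proj₂ (from e j)
  fg : ∀ j → f (g j) ≡ j
  fg zero = refl
  fg (suc j) = cong suc (strictlyInverseˡ e j)
  gf : ∀ v → g (f v) ≡ v
  gf (zero , t) = Σ-T-≡ p refl
  gf (suc i , t) = Σ-T-≡ p (cong (suc ∘ proj₁) (strictlyInverseʳ e (i , t)))

finite-subset : {A : Set} → Finite A → (p : A → Bool) → Finite (Σ A (T ∘ p))
finite-subset {A} (n , e) p with finite-Fin-subset n (p ∘ from e)
... | c , e′ = c , (e′ ↔-∘ mk↔ₛ′ f g fg gf)
  where
  f : Σ A (T ∘ p) → Σ (Fin n) (T ∘ p ∘ from e)
  f (a , t) = to e a , subst (T ∘ p) (sym (strictlyInverseʳ e a)) t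
  g : Σ (Fin n) (T ∘ p ∘ from e) → Σ A (T ∘ p)
  g (i , t) = from e i , t
  fg : ∀ v → f (g v) ≡ v
  fg (i , t) = Σ-T-≡ (p ∘ from e) (strictlyInverseˡ e i)
  gf : ∀ v → g (f v) ≡ v
  gf (a , t) = Σ-T-≡ p (strictlyInverseʳ e a)

record Graph : Set₁ where
  field
    V          : Set
    finite     : Finite V
    adj        : V → V → Bool
    adj-sym    : ∀ u v → adj u v ≡ adj v u
    adj-irrefl : ∀ v → adj v v ≡ false

open Graph public

Connected : Graph → Set
Connected X = ∀ u v → Star (λ a b → T (adj X a b)) u v

record Iso (X Y : Graph) : Set where
  constructor mkIso
  field
    bij       : V X ↔ V Y
    preserves : ∀ u v → adj Y (to bij u) (to bij v) ≡ adj X u v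

  ⟦_⟧ : V X → V Y
  ⟦_⟧ = to bij

open Iso public using (⟦_⟧)

Aut : Graph → Set
Aut X = Iso X X

idAut : (X : Graph) → Aut X
idAut X = mkIso (↔-id (V X)) (λ _ _ → refl)

infixr 9 _∘ᴬ_
_∘ᴬ_ : {X : Graph} → Aut X → Aut X → Aut X
mkIso b p ∘ᴬ mkIso c q = mkIso (b ↔-∘ c) (λ u v → trans (p _ _) (q u v))

invAut : {X : Graph} → Aut X → Aut X
invAut {X} (mkIso b p) = mkIso (↔-sym b) λ u v →
  trans (sym (p (from b u) (from b v)))
        (cong₂ (adj X) (strictlyInverseˡ b u) (strictlyInverseˡ b v))

-- Automorphisms are identified when they agree pointwise, hence ∈-resp;
-- membership is decidable so that orbits can be counted.
record Subgroup (X : Graph) : Set₁ where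
  field
    Member : Aut X → Set
    ∈?     : ∀ π → Dec (Member π)
    ∈-resp : ∀ {π ρ} → ⟦ π ⟧ ≗ ⟦ ρ ⟧ → Member π → Member ρ
    id∈    : Member (idAut X)
    ∘∈     : ∀ {π ρ} → Member π → Member ρ → Member (π ∘ᴬ ρ)
    inv∈   : ∀ {π} → Member π → Member (invAut π)

open Subgroup public using (Member)

Stab₁ : (X : Graph) → V X → Subgroup X
Stab₁ X a = record
  { Member = λ π → ⟦ π ⟧ a ≡ a
  ; ∈?     = λ π → ≟-finite (finite X) _ _
  ; ∈-resp = λ eq fix → trans (sym (eq a)) fix
  ; id∈    = refl
  ; ∘∈     = λ {π} p q → trans (cong ⟦ π ⟧ q) p
  ; inv∈   = λ {π} p → trans (cong (from (Iso.bij π)) (sym p)) (strictlyInverseʳ (Iso.bij π) a)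
  }

Stab₂ : (X : Graph) → V X → V X → Subgroup X
Stab₂ X a b = record
  { Member = λ π → Member A π × Member B π
  ; ∈?     = λ π → ∈? A π ×-dec ∈? B π
  ; ∈-resp = λ { {π} {ρ} eq (p , q) → ∈-resp A {π} {ρ} eq p , ∈-resp B {π} {ρ} eq q }
  ; id∈    = refl , refl
  ; ∘∈     = λ { {π} {ρ} (p , q) (r , s) → ∘∈ A {π} {ρ} p r , ∘∈ B {π} {ρ} q s }
  ; inv∈   = λ { {π} (p , q) → inv∈ A {π} p , inv∈ B {π} q }
  }
  where
  open Subgroup using (∈?; ∈-resp; id∈; ∘∈; inv∈)
  A B : Subgroup X
  A = Stab₁ X a
  B = Stab₁ X b

anyAut? : (X : Graph) {Q : Aut X → Set} →
          (∀ {π ρ} → ⟦ π ⟧ ≗ ⟦ ρ ⟧ → Q π → Q ρ) → (∀ π → Dec (Q π)) → Dec (∃ Q)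
anyAut? X {Q} resp Q? = map′
  (λ { (f , g , p , q) → mk f g p , q })
  (λ { (π , q) → ⟦ π ⟧ , from (Iso.bij π)
               , (strictlyInverseˡ (Iso.bij π) , strictlyInverseʳ (Iso.bij π) , Iso.preserves π)
               , resp {π} (λ _ → refl) q })
  (anyFunction? F F resp₁ λ f → anyFunction? F F (resp₂ f) λ g → P? f g)
  where
  F : Finite (V X)
  F = finite X

  IsAut : (f g : V X → V X) → Set
  IsAut f g = (∀ v → f (g v) ≡ v) × (∀ v → g (f v) ≡ v) × (∀ u v → adj X (f u) (f v) ≡ adj X u v)

  isAut? : ∀ f g → Dec (IsAut f g)
  isAut? f g = all-finite? F (λ v → ≟-finite F _ _)
         ×-dec all-finite? F (λ v → ≟-finite F _ _)
         ×-dec all-finite? F (λ u → all-finite? F (λ v → _ ≟ᵇ _))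

  mk : ∀ f g → IsAut f g → Aut X
  mk f g (fg , gf , p) = mkIso (mk↔ₛ′ f g fg gf) p

  P : (f g : V X → V X) → Set
  P f g = Σ (IsAut f g) (λ p → Q (mk f g p))

  P? : ∀ f g → Dec (P f g)
  P? f g with isAut? f g
  ... | no ¬p = no (¬p ∘ proj₁)
  ... | yes p = map′ (p ,_) (λ { (p′ , q) → resp {mk f g p′} (λ _ → refl) q }) (Q? (mk f g p))

  resp-P : ∀ {f f′ g g′} → f ≗ f′ → g ≗ g′ → P f g → P f′ g′
  resp-P {f} {f′} {g} {g′} ff gg (p@(fg , gf , a) , q) = p′ , resp {mk f g p} ff q
    where
    p′ : IsAut f′ g′
    p′ = (λ v → trans (sym (trans (cong f (gg v)) (ff (g′ v)))) (fg v))
       , (λ v → trans (sym (trans (cong g (ff v)) (gg (f′ v)))) (gf v))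
       , (λ u v → trans (sym (cong₂ (adj X) (ff u) (ff v))) (a u v))

  resp₁ : ∀ {f f′} → f ≗ f′ → ∃ (P f) → ∃ (P f′)
  resp₁ ff (g , p) = g , resp-P ff (λ _ → refl) p

  resp₂ : ∀ f {g g′} → g ≗ g′ → P f g → P f g′
  resp₂ f gg = resp-P (λ _ → refl) gg

Labeling : Graph → ℕ → Set
Labeling X k = V X → Fin k

module _ {X : Graph} {k : ℕ} where

  Preserves : Aut X → Labeling X k → Set
  Preserves π φ = ∀ v → φ (⟦ π ⟧ v) ≡ φ v

  Distinguishing : Subgroup X → Labeling X k → Set
  Distinguishing Γ φ = ∀ π → Member Γ π → Preserves π φ → ⟦ π ⟧ ≗ id

  Equivalent : Subgroup X → Labeling X k → Labeling X k → Set
  Equivalent Γ φ φ′ = ∃ λ π → Member Γ π × (∀ v → φ′ (⟦ π ⟧ v) ≡ φ v)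

  distinguishing? : ∀ Γ φ → Dec (Distinguishing Γ φ)
  distinguishing? Γ φ = map′
    (λ none π π∈ pres → decidable-stable (id? π) (λ π≢id → none (π , π∈ , pres , π≢id)))
    (λ { dist (π , π∈ , pres , π≢id) → π≢id (dist π π∈ pres) })
    (¬? (anyAut? X resp λ π →
      Subgroup.∈? Γ π ×-dec all-finite? F (λ v → _ ≟ᶠ _) ×-dec ¬? (id? π)))
    where
    F : Finite (V X)
    F = finite X
    id? : ∀ π → Dec (⟦ π ⟧ ≗ id)
    id? π = all-finite? F (λ v → ≟-finite F _ _)
    Bad : Aut X → Set
    Bad π = Member Γ π × Preserves π φ × ¬ (⟦ π ⟧ ≗ id)
    resp : ∀ {π ρ} → ⟦ π ⟧ ≗ ⟦ ρ ⟧ → Bad π → Bad ρ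
    resp {π} {ρ} eq (π∈ , pres , π≢id) =
        Subgroup.∈-resp Γ {π} {ρ} eq π∈
      , (λ v → trans (cong φ (sym (eq v))) (pres v))
      , (λ ρ≡id → π≢id (λ v → trans (eq v) (ρ≡id v)))

  equivalent? : ∀ Γ φ φ′ → Dec (Equivalent Γ φ φ′)
  equivalent? Γ φ φ′ = anyAut? X
    (λ { {π} {ρ} eq (π∈ , h) → Subgroup.∈-resp Γ {π} {ρ} eq π∈
                             , (λ v → trans (cong φ′ (sym (eq v))) (h v)) })
    (λ π → Subgroup.∈? Γ π ×-dec all-finite? (finite X) (λ v → _ ≟ᶠ _))

labelings : (X : Graph) (k : ℕ) → List (Labeling X k)
labelings X k = tabulate (decode (finite X) (k , ↔-id (Fin k)))

-- deduplicate keeps exactly one representative of each equivalence class.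
D : (X : Graph) → ℕ → Subgroup X → ℕ
D X k Γ = length (deduplicate (equivalent? Γ) (filter (distinguishing? Γ) (labelings X k)))

D₁ : (X : Graph) → ℕ → V X → ℕ
D₁ X k a = D X k (Stab₁ X a)

D₂ : (X : Graph) → ℕ → V X → V X → ℕ
D₂ X k x y = D X k (Stab₂ X x y)

record Subgraph (G : Graph) : Set where
  field
    inV     : V G → Bool
    inE     : V G → V G → Bool
    inE-sym : ∀ u v → inE u v ≡ inE v u
    inE⇒inV : ∀ u v → T (inE u v) → T (inV u)
    inE⇒adj : ∀ u v → T (inE u v) → T (adj G u v)

open Subgraph public using (inV; inE)

module _ {G : Graph} where

  infix 4 _∈ⱽ_
  _∈ⱽ_ : V G → Subgraph G → Set
  v ∈ⱽ S = T (inV S v)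

  ⌊_⌋ : Subgraph G → Graph
  ⌊ S ⌋ = record
    { V          = Σ (V G) (_∈ⱽ S)
    ; finite     = finite-subset (finite G) (inV S)
    ; adj        = λ u v → inE S (proj₁ u) (proj₁ v)
    ; adj-sym    = λ u v → Subgraph.inE-sym S _ _
    ; adj-irrefl = λ v → irrefl (proj₁ v)
    }
    where
    irrefl : ∀ v → inE S v v ≡ false
    irrefl v with inE S v v in eq
    ... | false = refl
    ... | true = ⊥-elim (subst T (adj-irrefl G v)
                   (Subgraph.inE⇒adj S v v (subst T (sym eq) tt)))

  SameSubgraph : Subgraph G → Subgraph G → Set
  SameSubgraph S S′ = (∀ v → inV S v ≡ inV S′ v) × (∀ u v → inE S u v ≡ inE S′ u v)

  -- π(S) = S′ as subgraphs, i.e. on vertices and on edges (π is bijective).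
  MapsOnto : Aut G → Subgraph G → Subgraph G → Set
  MapsOnto π S S′ = (∀ v → inV S′ (⟦ π ⟧ v) ≡ inV S v)
                  × (∀ u v → inE S′ (⟦ π ⟧ u) (⟦ π ⟧ v) ≡ inE S u v)

record BiRooted : Set₁ where
  constructor biRooted
  field
    graph  : Graph
    rootˣ  : V graph
    rootʸ  : V graph

open BiRooted public

RootedIso : BiRooted → BiRooted → Set
RootedIso (biRooted X x y) (biRooted Y x′ y′) =
  Σ (Iso X Y) λ f → ⟦ f ⟧ x ≡ x′ × ⟦ f ⟧ y ≡ y′

record Link (G : Graph) (x y : V G) : Set where
  field
    sub       : Subgraph G
    connected : Connected ⌊ sub ⌋
    x∈        : x ∈ⱽ sub
    y∈        : y ∈ⱽ sub

  rooted : BiRooted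
  rooted = biRooted ⌊ sub ⌋ (x , x∈) (y , y∈)

-- With (z , w) = (x , y) this is a candidate for A_x, with (y , x) for A_y.
record Arm (G : Graph) (z w : V G) : Set where
  field
    sub       : Subgraph G
    connected : Connected ⌊ sub ⌋
    z∈        : z ∈ⱽ sub
    w∉        : ¬ (w ∈ⱽ sub)

  root : V ⌊ sub ⌋
  root = z , z∈

data Part (m : ℕ) : Set where
  link      : Fin m → Part m
  armˣ armʸ : Part m

record Pieces (G : Graph) (x y : V G) (m : ℕ) : Set where
  field
    H  : Fin m → Link G x y
    Aˣ : Maybe (Arm G x y)
    Aʸ : Maybe (Arm G y x)

  Hs : Fin m → Subgraph G
  Hs j = Link.sub (H j)

  part : Part m → Maybe (Subgraph G)
  part (link j) = just (Hs j)
  part armˣ     = mapMaybe Arm.sub Aˣ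
  part armʸ     = mapMaybe Arm.sub Aʸ

  VertexOf : Part m → V G → Set
  VertexOf p v = Any (v ∈ⱽ_) (part p)

  EdgeOf : Part m → V G → V G → Set
  EdgeOf p u v = Any (λ S → T (inE S u v)) (part p)

  IsXY : V G → V G → Set
  IsXY u v = (u ≡ x × v ≡ y) ⊎ (u ≡ y × v ≡ x)

record IsDecomposition {G : Graph} {x y : V G} {m : ℕ} (𝒫 : Pieces G x y m) : Set where
  open Pieces 𝒫
  field
    cover-V : ∀ v → ∃ λ p → VertexOf p v
    cover-E : ∀ u v → T (adj G u v) → ∃ λ p → EdgeOf p u v

    -- H₁, …, Hₘ are m different subgraphs; in view of H∩H this only excludes
    -- listing the single edge xy more than once.
    H-distinct : ∀ j l → j ≢ l → ¬ SameSubgraph (Hs j) (Hs l)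

    H∩H  : ∀ j l → j ≢ l → ∀ v → v ∈ⱽ Hs j → v ∈ⱽ Hs l → v ≡ x ⊎ v ≡ y
    Aˣ∩H : All (λ A → ∀ j v → v ∈ⱽ Arm.sub A → v ∈ⱽ Hs j → v ≡ x) Aˣ
    Aʸ∩H : All (λ A → ∀ j v → v ∈ⱽ Arm.sub A → v ∈ⱽ Hs j → v ≡ y) Aʸ
    Aˣ∩Aʸ : All (λ A → All (λ B → ∀ v → v ∈ⱽ Arm.sub A → ¬ (v ∈ⱽ Arm.sub B)) Aʸ) Aˣ

    edge-unique : ∀ u v → T (adj G u v) → ¬ IsXY u v → ∃! _≡_ λ p → EdgeOf p u v

    Aˣ-invariant : ∀ π → Member (Stab₂ G x y) π →
                   All (λ A → MapsOnto π (Arm.sub A) (Arm.sub A)) Aˣ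
    Aʸ-invariant : ∀ π → Member (Stab₂ G x y) π →
                   All (λ A → MapsOnto π (Arm.sub A) (Arm.sub A)) Aʸ
    H-permuted   : ∀ π → Member (Stab₂ G x y) π →
                   Σ (Fin m ↔ Fin m) λ σ → ∀ j → MapsOnto π (Hs j) (Hs (to σ j))

-- The partition of H₁, …, Hₘ into g isomorphism classes (isomorphisms fixing
-- x and y), with a model Gᵢ of each class carrying its own copies of x and y.
record Classes {G : Graph} {x y : V G} {m : ℕ}
               (𝒫 : Pieces G x y m) (g : ℕ) : Set₁ where
  open Pieces 𝒫 using (H)
  field
    class    : Fin m → Fin g
    nonempty : ∀ i → ∃ λ j → class j ≡ i
    class-≡  : ∀ j l → class j ≡ class l ⇔ RootedIso (Link.rooted (H j)) (Link.rooted (H l))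
    model    : Fin g → BiRooted
    H≅model  : ∀ j → RootedIso (Link.rooted (H j)) (model (class j))

  multiplicity : Fin g → ℕ
  multiplicity i = length (filter (λ j → class j ≟ᶠ i) (allFin m))

D-rooted : BiRooted → ℕ → ℕ
D-rooted X k = D₂ (graph X) k (rootˣ X) (rootʸ X)

D-arm : {G : Graph} {z w : V G} → Arm G z w → ℕ → ℕ
D-arm A k = D₁ ⌊ Arm.sub A ⌋ k (Arm.root A)

α : {G : Graph} {z w : V G} → Maybe (Arm G z w) → (k : ℕ) .{{_ : NonZero k}} → ℕ
α (just A) k = D-arm A k / k
α nothing  k = 1

_/_² : ℕ → (k : ℕ) .{{_ : NonZero k}} → ℕ
d / k ² = (d / (k ^ 2)) {{m^n≢0 k 2}}

{-# OPTIONS --safe #-}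
module Submission where

-- Every automorphism in question fixes the roots x and y, so root labels are free:
-- they contribute one factor k per root, and what is left to count is the number of
-- distinguishing labelings up to equivalence away from the roots (`rigidCount`).  An
-- automorphism of G fixing x and y amounts to a permutation of the pieces together
-- with root-preserving isomorphisms between them.  Hence a labeling of G is
-- distinguishing iff its restriction to each piece is and isomorphic pieces get
-- inequivalent restrictions, and up to equivalence it is a choice, for every
-- isomorphism class of pieces, of an mᵢ-element subset of the rigid classes of Gᵢ.
-- The arms are classes with a single member; an absent arm is replaced by the one-vertex
-- subgraph at its root, which has exactly one rigid class.

open import Defs
open import Data.Bool.Base using (Bool; true; false; T)
open import Data.Bool.Properties using () renaming (_≟_ to _≟ᵇ_)
open import Data.Empty using (⊥-elim; ⊥)
open import Data.Fin.Base using (Fin; zero; suc; finToFun; funToFin; combine; remQuot; join; splitAt)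
open import Data.Fin.Permutation using (transpose; lift₀)
open import Data.Fin.Properties using (any?; finToFun-funToFin; funToFin-finToFin; injective⇒≤; remQuot-combine; combine-remQuot; splitAt-join; join-splitAt; suc-injective) renaming (_≟_ to _≟ᶠ_)
open import Data.List.Base using (List; []; _∷_; length; filter; allFin; lookup; tabulate; deduplicate)
open import Data.List.Membership.Propositional.Properties using (∈-filter⁺; ∈-allFin; ∈-lookup; ∈-tabulate⁺)
open import Data.List.Properties using () renaming (tabulate-cong to list-tabulate-cong)
open import Data.List.Relation.Unary.All as ListAll using ([]; _∷_)
open import Data.List.Relation.Unary.All.Properties using (all-filter) renaming (deduplicate⁺ to all-deduplicate⁺)
open import Data.List.Relation.Unary.AllPairs using (AllPairs; []; _∷_)
open import Data.List.Relation.Unary.Any using (here; there) renaming (Any to ListAny; index to position; map to map-Any)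
open import Data.List.Relation.Unary.Any.Properties using () renaming (deduplicate⁺ to any-deduplicate⁺)
open import Data.List.Relation.Unary.Unique.DecSetoid.Properties using (deduplicate-!)
open import Data.List.Relation.Unary.Unique.Propositional.Properties using (allFin⁺) renaming (filter⁺ to unique-filter⁺)
open import Data.Maybe.Base using (Maybe; just; nothing)
open import Data.Maybe.Properties using () renaming (≡-dec to Maybe-≡-dec)
open import Data.Maybe.Relation.Unary.All using (All; just; nothing) renaming (map to map-All)
open import Data.Maybe.Relation.Unary.Any using (just)
open import Data.Nat.Base using (ℕ; zero; suc; _+_; _*_; _^_; _≤_; z≤n; NonZero)
open import Data.Nat.Combinatorics using (_C_; nCn≡1; nCk≡nC[n∸k]; nCk+nC[k+1]≡[n+1]C[k+1]; nC1≡n)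
open import Data.Nat.DivMod using (_/_; m*n/n≡m)
open import Data.Nat.Divisibility using (_∣_; m∣m*n)
open import Data.Nat.ListAction using (product)
open import Data.Nat.Properties using (≤-antisym; *-comm; *-assoc; *-identityʳ; m^n≢0) renaming (suc-injective to ℕ-suc-injective)
open import Data.Product using (Σ; ∃; _×_; _,_; proj₁; proj₂)
open import Data.Product.Properties using () renaming (≡-dec to Σ-≡-dec)
open import Data.Product.Properties.WithK using (,-injectiveʳ)
open import Data.Sum.Base using (_⊎_; inj₁; inj₂)
open import Data.Unit.Base using (⊤; tt)
open import Data.Vec.Base using (Vec; []; _∷_; tail) renaming (lookup to vlookup; tabulate to vtabulate)
open import Data.Vec.Properties using (tabulate∘lookup; tabulate-cong) renaming (lookup∘tabulate to vlookup∘tabulate)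
open import Function.Base using (_∘_; _on_; _∋_; id)
open import Function.Bundles using (_↔_; mk⇔; mk↔ₛ′; Inverse; Equivalence; Injection; _⇔_)
open import Function.Construct.Composition using (_↔-∘_)
open import Function.Construct.Identity using (↔-id)
open import Function.Construct.Symmetry using (↔-sym)
open import Function.Definitions using (Injective)
open import Function.Properties.Inverse using (↔⇒↣)
open import Relation.Binary.Construct.Closure.ReflexiveTransitive using (Star; ε)
open import Relation.Binary.PropositionalEquality using (_≡_; _≢_; _≗_; refl; sym; trans; cong; cong₂; subst; isEquivalence; subst₂; module ≡-Reasoning)
open import Relation.Binary.Structures using (IsEquivalence)
open import Relation.Nullary using (¬_; Dec; yes; no; does; contradiction)
open import Relation.Nullary.Decidable using (does-⇔; T?; map′; _×-dec_; _→-dec_; decidable-stable)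

open Inverse using (to; from; strictlyInverseˡ; strictlyInverseʳ)
open Pieces using (Aˣ)
open Pieces using (Aʸ)
open Classes using (model)
open Classes using (multiplicity)

-- No quotients are formed: `D` is the length of a deduplicated list, and `Enumeration` is the
-- interface to it. Two numbers that enumerate the same relation are equal, so an identity between
-- counts comes from a map that respects and reflects relations. Relations are taken `on proj₁`, so
-- proofs of being distinguishing or rigid never affect a count.
--
-- The obstacle is that pieces overlap in the roots. Tagging the roots lets a subgraph inherit
-- whichever roots it contains, so arms with one root and links with two are treated alike, and
-- every tag-preserving isomorphism between pieces leaves the shared vertices in place. Ignoring
-- root labels lets labelings chosen piece by piece be merged without conflict.
--
-- One degenerate case remains. A piece all of whose vertices are roots, such as the single edge xy,
-- could be listed twice; swapping the two copies would move no vertex, so rigidity could not force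
-- different labelings on them. `H-distinct` excludes this.

-- Numbers of classes of a relation

does⁻ : {A : Set} (a? : Dec A) → T (does a?) → A
does⁻ (yes a) _ = a

does⁺ : {A : Set} (a? : Dec A) → A → T (does a?)
does⁺ (yes _) _ = tt
does⁺ (no ¬a) a = ¬a a

-- `Enumeration _≈_ n`: the relation _≈_ has exactly n classes.  That _≈_ is an
-- equivalence is a consequence, so it is never asked for.
record Enumeration {A : Set} (_≈_ : A → A → Set) (n : ℕ) : Set where
  field
    index      : A → Fin n
    rep        : Fin n → A
    index-cong : ∀ {a b} → a ≈ b → index a ≡ index b
    index-inj  : ∀ {a b} → index a ≡ index b → a ≈ b
    index-rep  : ∀ i → index (rep i) ≡ i

open Enumeration


-- Representatives of different `E`-classes are unrelated, so their `F`-indices differ.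
enumeration-≤ : {A : Set} {_≈_ : A → A → Set} {m n : ℕ} →
                Enumeration _≈_ m → Enumeration _≈_ n → m ≤ n
enumeration-≤ E F = injective⇒≤ {f = index F ∘ rep E} λ {i} {j} eq →
  trans (sym (index-rep E i)) (trans (index-cong E (index-inj F eq)) (index-rep E j))

enumeration-unique : {A : Set} {_≈_ : A → A → Set} {m n : ℕ} →
                     Enumeration _≈_ m → Enumeration _≈_ n → m ≡ n
enumeration-unique E F = ≤-antisym (enumeration-≤ E F) (enumeration-≤ F E)

-- The way almost every count below is obtained. Surjectivity is asked for only up to `_≈′_`, so a
-- preimage has to hit the right class and not the exact element.
pullback : {A B : Set} {_≈_ : A → A → Set} {_≈′_ : B → B → Set} {n : ℕ} (f : A → B) →
           (∀ {a b} → a ≈ b → f a ≈′ f b) → (∀ {a b} → f a ≈′ f b → a ≈ b) →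
           (∀ b → ∃ λ a → f a ≈′ b) → Enumeration _≈′_ n → Enumeration _≈_ n
pullback f f-cong f-inj f-surj E = record
  { index      = index E ∘ f
  ; rep        = proj₁ ∘ f-surj ∘ rep E
  ; index-cong = index-cong E ∘ f-cong
  ; index-inj  = f-inj ∘ index-inj E
  ; index-rep  = λ i → trans (index-cong E (proj₂ (f-surj (rep E i)))) (index-rep E i)
  }

_≈×_ : {A B : Set} → (A → A → Set) → (B → B → Set) → A × B → A × B → Set
(R ≈× S) (a , b) (a′ , b′) = R a a′ × S b b′

×-enumeration : {A B : Set} {R : A → A → Set} {S : B → B → Set} {m n : ℕ} →
                Enumeration R m → Enumeration S n → Enumeration (R ≈× S) (m * n)
×-enumeration {m = m} {n} E F = record
  { index      = λ { (a , b) → combine (index E a) (index F b) }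
  ; rep        = λ i → rep E (proj₁ (remQuot {m} n i)) , rep F (proj₂ (remQuot {m} n i))
  ; index-cong = λ { (p , q) → cong₂ combine (index-cong E p) (index-cong F q) }
  ; index-inj  = λ { {a , b} {a′ , b′} eq →
      let eq′ = trans (sym (remQuot-combine (index E a) (index F b)))
                      (trans (cong (remQuot n) eq) (remQuot-combine (index E a′) (index F b′)))
      in index-inj E (cong proj₁ eq′) , index-inj F (cong proj₂ eq′) }
  ; index-rep  = λ i → trans (cong₂ combine (index-rep E _) (index-rep F _)) (combine-remQuot {m} n i)
  }

data _≈⊎_ {A B : Set} (R : A → A → Set) (S : B → B → Set) : A ⊎ B → A ⊎ B → Set where
  inj₁ : ∀ {a a′} → R a a′ → (R ≈⊎ S) (inj₁ a) (inj₁ a′)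
  inj₂ : ∀ {b b′} → S b b′ → (R ≈⊎ S) (inj₂ b) (inj₂ b′)

⊎-enumeration : {A B : Set} {R : A → A → Set} {S : B → B → Set} {m n : ℕ} →
                Enumeration R m → Enumeration S n → Enumeration (R ≈⊎ S) (m + n)
⊎-enumeration {A} {B} {R} {S} {m} {n} E F = record
  { index      = join m n ∘ ix
  ; rep        = rp ∘ splitAt m
  ; index-cong = λ { (inj₁ p) → cong (join m n ∘ inj₁) (index-cong E p)
                   ; (inj₂ p) → cong (join m n ∘ inj₂) (index-cong F p) }
  ; index-inj  = λ {a} {b} eq → ix-inj a b
      (trans (sym (splitAt-join m n (ix a))) (trans (cong (splitAt m) eq) (splitAt-join m n (ix b))))
  ; index-rep  = λ i → trans (cong (join m n) (ix-rp (splitAt m i))) (join-splitAt m n i)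
  }
  where
  ix : A ⊎ B → Fin m ⊎ Fin n
  ix (inj₁ a) = inj₁ (index E a)
  ix (inj₂ b) = inj₂ (index F b)
  rp : Fin m ⊎ Fin n → A ⊎ B
  rp (inj₁ i) = inj₁ (rep E i)
  rp (inj₂ i) = inj₂ (rep F i)
  ix-inj : ∀ a b → ix a ≡ ix b → (R ≈⊎ S) a b
  ix-inj (inj₁ a) (inj₁ b) eq = inj₁ (index-inj E (inj₁-inj eq))
    where
    inj₁-inj : ∀ {i j : Fin m} → inj₁ {B = Fin n} i ≡ inj₁ j → i ≡ j
    inj₁-inj refl = refl
  ix-inj (inj₂ a) (inj₂ b) eq = inj₂ (index-inj F (inj₂-inj eq))
    where
    inj₂-inj : ∀ {i j : Fin n} → inj₂ {A = Fin m} i ≡ inj₂ j → i ≡ j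
    inj₂-inj refl = refl
  ix-inj (inj₁ a) (inj₂ b) ()
  ix-inj (inj₂ a) (inj₁ b) ()
  ix-rp : ∀ s → ix (rp s) ≡ s
  ix-rp (inj₁ i) = cong inj₁ (index-rep E i)
  ix-rp (inj₂ i) = cong inj₂ (index-rep F i)

one-class : {A : Set} {_≈_ : A → A → Set} → A → (∀ a b → a ≈ b) → Enumeration _≈_ 1
one-class a₀ related = record
  { index      = λ _ → zero
  ; rep        = λ _ → a₀
  ; index-cong = λ _ → refl
  ; index-inj  = λ _ → related _ _
  ; index-rep  = λ { zero → refl }
  }

no-class : {A : Set} {_≈_ : A → A → Set} → ¬ A → Enumeration _≈_ 0
no-class ¬a = record
  { index      = λ a → ⊥-elim (¬a a)
  ; rep        = λ ()
  ; index-cong = λ {a} _ → ⊥-elim (¬a a)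
  ; index-inj  = λ {a} _ → ⊥-elim (¬a a)
  ; index-rep  = λ ()
  }

funToFin-cong : ∀ {m n} {f g : Fin m → Fin n} → f ≗ g → funToFin f ≡ funToFin g
funToFin-cong {zero}  eq = refl
funToFin-cong {suc m} eq = cong₂ combine (eq zero) (funToFin-cong (eq ∘ suc))

function-enumeration : ∀ m n → Enumeration {Fin m → Fin n} _≗_ (n ^ m)
function-enumeration m n = record
  { index      = funToFin
  ; rep        = finToFun
  ; index-cong = funToFin-cong
  ; index-inj  = λ {f} {g} eq i → trans (sym (finToFun-funToFin f i))
                   (trans (cong (λ c → finToFun c i) eq) (finToFun-funToFin g i))
  ; index-rep  = funToFin-finToFin {m} {n}
  }

Π-enumeration : ∀ g {A : Fin g → Set} {_≈_ : ∀ i → A i → A i → Set} {n : Fin g → ℕ} →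
                (∀ i → Enumeration (_≈_ i) (n i)) →
                Enumeration {∀ i → A i} (λ f h → ∀ i → (i ≈ f i) (h i)) (product (tabulate n))
Π-enumeration zero E = one-class (λ ()) (λ _ _ ())
Π-enumeration (suc g) {A} {_≈_} E =
  pullback {_≈′_ = _≈_ zero ≈× (λ f h → ∀ i → (suc i ≈ f i) (h i))}
    (λ f → f zero , f ∘ suc)
    (λ p → p zero , p ∘ suc)
    (λ { (p , q) zero → p ; (p , q) (suc i) → q i })
    (λ { (a , f) → (λ { zero → a ; (suc i) → f i })
                 -- Reflexivity is not assumed; it comes from an index being equal to itself.
                 , index-inj (E zero) refl , λ i → index-inj (E (suc i)) refl })
    (×-enumeration (E zero) (Π-enumeration g (E ∘ suc)))

-- Class counts from lists of representatives

module _ {A : Set} {_≈_ : A → A → Set} (isEquivalence : IsEquivalence _≈_) where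

  open IsEquivalence isEquivalence renaming (refl to ≈-refl; sym to ≈-sym; trans to ≈-trans)

  -- An element is related to at most one entry of a list of pairwise unrelated elements, so the
  -- place where it is found depends only on its class.
  same-position : ∀ {a b xs} → AllPairs (λ c d → ¬ (c ≈ d)) xs →
                  (p : ListAny (a ≈_) xs) (q : ListAny (b ≈_) xs) →
                  a ≈ b → position p ≡ position q
  same-position u (here p) (here q) r = refl
  same-position (n ∷ u) (here p) (there q) r =
    ⊥-elim (separated n q (≈-trans (≈-sym p) r))
    where
    separated : ∀ {c b xs} → ListAll.All (λ d → ¬ (c ≈ d)) xs → ListAny (b ≈_) xs → ¬ (c ≈ b)
    separated (n ∷ _) (here q) r = n (≈-trans r q)
    separated (_ ∷ n) (there q) r = separated n q r
  same-position u@(_ ∷ _) (there p) (here q) r = sym (same-position u (here q) (there p) (≈-sym r))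
  same-position (_ ∷ u) (there p) (there q) r = cong suc (same-position u p q r)

  list-enumeration : {P : A → Set} (xs : List A) → ListAll.All P xs →
                     AllPairs (λ a b → ¬ (a ≈ b)) xs → (∀ a → P a → ListAny (a ≈_) xs) →
                     Enumeration {Σ A P} (_≈_ on proj₁) (length xs)
  list-enumeration {P} xs all unique complete = record
    { index      = λ { (a , p) → position (complete a p) }
    ; rep        = λ i → lookup xs i , ListAll.lookup all (∈-lookup i)
    ; index-cong = λ { {a , p} {b , q} r → same-position unique (complete a p) (complete b q) r }
    ; index-inj  = λ { {a , p} {b , q} eq → related (complete a p) (complete b q) eq }
    -- `complete` may find entry `i` through another witness than the evident one, `itself`;
    -- uniqueness identifies the two positions.
    ; index-rep  = λ i → trans (same-position unique (complete _ (ListAll.lookup all (∈-lookup i))) (itself xs i) ≈-refl)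
                               (itself-position xs i)
    }
    where
    related : ∀ {a b xs} (p : ListAny (a ≈_) xs) (q : ListAny (b ≈_) xs) →
              position p ≡ position q → a ≈ b
    related (here p) (here q) eq = ≈-trans p (≈-sym q)
    related (there p) (there q) eq = related p q (suc-injective eq)
    related (here p) (there q) ()
    related (there p) (here q) ()
    itself : ∀ xs i → ListAny (lookup xs i ≈_) xs
    itself (_ ∷ _) zero = here ≈-refl
    itself (_ ∷ xs) (suc i) = there (itself xs i)
    itself-position : ∀ xs i → position (itself xs i) ≡ i
    itself-position (_ ∷ _) zero = refl
    itself-position (_ ∷ xs) (suc i) = cong suc (itself-position xs i)

filter-enumeration : ∀ {n} {P : Fin n → Set} (P? : ∀ i → Dec (P i)) →
                     Enumeration {Σ (Fin n) P} (_≡_ on proj₁) (length (filter P? (allFin n)))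
filter-enumeration {n} P? = list-enumeration isEquivalence (filter P? (allFin n))
  (all-filter P? (allFin n)) (unique-filter⁺ P? (allFin⁺ n)) (λ i → ∈-filter⁺ P? (∈-allFin i))

-- Subsets of Fin n

size : ∀ {n} → Vec Bool n → ℕ
size []          = 0
size (true ∷ p)  = suc (size p)
size (false ∷ p) = size p

Members : ∀ {n} → Vec Bool n → Set
Members {n} p = Σ (Fin n) λ a → T (vlookup p a)

members-enumeration : ∀ {n} (p : Vec Bool n) → Enumeration {Members p} (_≡_ on proj₁) (size p)
members-enumeration [] = no-class λ { (() , _) }
members-enumeration (false ∷ p) = pullback
  {_≈′_ = _≡_ on proj₁}
  (λ { (suc a , t) → a , t })
  (λ { {suc _ , _} {suc _ , _} → suc-injective })
  (λ { {suc _ , _} {suc _ , _} → cong suc })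
  (λ { (a , t) → (suc a , t) , refl })
  (members-enumeration p)
members-enumeration {suc n} (true ∷ p) = pullback
  {_≈_ = _≡_ on proj₁} {_≈′_ = (λ _ _ → ⊤) ≈⊎ (_≡_ on proj₁)}
  split split-cong split-inj
  (λ { (inj₁ tt) → (zero , tt) , inj₁ tt ; (inj₂ (a , t)) → (suc a , t) , inj₂ refl })
  (⊎-enumeration (one-class tt λ _ _ → tt) (members-enumeration p))
  where
  split : Members (true ∷ p) → ⊤ ⊎ Members p
  split (zero , _) = inj₁ tt
  split (suc a , t) = inj₂ (a , t)
  split-cong : ∀ {u v} → proj₁ u ≡ proj₁ v → ((λ _ _ → ⊤) ≈⊎ (_≡_ on proj₁)) (split u) (split v)
  split-cong {zero , _} {zero , _} eq = inj₁ tt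
  split-cong {suc _ , _} {suc _ , _} eq = inj₂ (suc-injective eq)
  split-inj : ∀ {u v} → ((λ _ _ → ⊤) ≈⊎ (_≡_ on proj₁)) (split u) (split v) → proj₁ u ≡ proj₁ v
  split-inj {zero , _} {zero , _} _ = refl
  split-inj {suc _ , _} {suc _ , _} (inj₂ eq) = cong suc eq

-- Subsets are bit vectors and not predicates, so that subsets with the same members are
-- propositionally equal and can be counted by their first component.
Sized : ℕ → ℕ → Set
Sized n m = Σ (Vec Bool n) λ p → size p ≡ m

nC0≡1 : ∀ n → n C 0 ≡ 1
nC0≡1 n = trans (nCk≡nC[n∸k] {0} {n} z≤n) (nCn≡1 n)

-- Splitting on the first bit is Pascal's rule.
sized-enumeration : ∀ n m → Enumeration {Sized n m} (_≡_ on proj₁) (n C m)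
sized-enumeration zero zero = one-class ([] , refl) λ { ([] , _) ([] , _) → refl }
sized-enumeration zero (suc m) = no-class λ { ([] , ()) }
sized-enumeration (suc n) zero =
  subst (Enumeration _) (trans (nC0≡1 n) (sym (nC0≡1 (suc n))))
    (pullback {_≈′_ = _≡_ on proj₁}
      (λ { (false ∷ p , eq) → p , eq ; (true ∷ p , ()) })
      (λ { {false ∷ _ , _} {false ∷ _ , _} → cong tail ; {true ∷ _ , ()} ; {_} {true ∷ _ , ()} })
      (λ { {false ∷ _ , _} {false ∷ _ , _} → cong (false ∷_) ; {true ∷ _ , ()} ; {_} {true ∷ _ , ()} })
      (λ { (p , eq) → (false ∷ p , eq) , refl })
      (sized-enumeration n zero))
sized-enumeration (suc n) (suc m) =
  subst (Enumeration _) (nCk+nC[k+1]≡[n+1]C[k+1] n m)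
    (pullback {_≈′_ = (_≡_ on proj₁) ≈⊎ (_≡_ on proj₁)} split split-cong split-inj
      (λ { (inj₁ (p , eq)) → (true ∷ p , cong suc eq) , inj₁ refl
         ; (inj₂ (p , eq)) → (false ∷ p , eq) , inj₂ refl })
      (⊎-enumeration (sized-enumeration n m) (sized-enumeration n (suc m))))
  where
  split : Sized (suc n) (suc m) → Sized n m ⊎ Sized n (suc m)
  split (true ∷ p , eq) = inj₁ (p , ℕ-suc-injective eq)
  split (false ∷ p , eq) = inj₂ (p , eq)
  split-cong : ∀ {u v} → proj₁ u ≡ proj₁ v → ((_≡_ on proj₁) ≈⊎ (_≡_ on proj₁)) (split u) (split v)
  split-cong {true ∷ _ , _} {true ∷ _ , _} eq = inj₁ (cong tail eq)
  split-cong {false ∷ _ , _} {false ∷ _ , _} eq = inj₂ (cong tail eq)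
  split-inj : ∀ {u v} → ((_≡_ on proj₁) ≈⊎ (_≡_ on proj₁)) (split u) (split v) → proj₁ u ≡ proj₁ v
  split-inj {true ∷ _ , _} {true ∷ _ , _} (inj₁ eq) = cong (true ∷_) eq
  split-inj {false ∷ _ , _} {false ∷ _ , _} (inj₂ eq) = cong (false ∷_) eq

-- Injective choices of a colour in Fin (d i) for each item of class i

module Selections {m g : ℕ} (class : Fin m → Fin g) (d : Fin g → ℕ) where

  -- The colours available to an item depend on its class. Bundling the class with the colour makes
  -- colours of arbitrary items comparable by plain equality.
  Key : Set
  Key = Σ (Fin g) λ i → Fin (d i)

  _≟ᵏ_ : (κ κ′ : Key) → Dec (κ ≡ κ′)
  _≟ᵏ_ = Σ-≡-dec _≟ᶠ_ _≟ᶠ_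

  Selection : Set
  Selection = Σ (Fin m → Key) λ c → (∀ j → proj₁ (c j) ≡ class j) × Injective _≡_ _≡_ c

  -- Such a `σ` preserves classes automatically, because a key carries its class.
  _~_ : Selection → Selection → Set
  (c , _) ~ (c′ , _) = Σ (Fin m ↔ Fin m) λ σ → ∀ j → c′ (to σ j) ≡ c j

  Fibre : Fin g → Set
  Fibre i = Σ (Fin m) λ j → class j ≡ i

  module _ {mult : Fin g → ℕ} (fibres : ∀ i → Enumeration {Fibre i} (_≡_ on proj₁) (mult i)) where

    hit? : (c : Fin m → Key) (κ : Key) → Dec (∃ λ j → c j ≡ κ)
    hit? c κ = any? λ j → c j ≟ᵏ κ

    image : (c : Fin m → Key) (i : Fin g) → Vec Bool (d i)
    image c i = vtabulate λ a → does (hit? c (i , a))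

    ∈-image⁻ : ∀ c {i a} → T (vlookup (image c i) a) → ∃ λ j → c j ≡ (i , a)
    ∈-image⁻ c {i} {a} t = does⁻ (hit? c (i , a)) (subst T (vlookup∘tabulate _ a) t)

    ∈-image⁺ : ∀ c {i a j} → c j ≡ (i , a) → T (vlookup (image c i) a)
    ∈-image⁺ c {i} {a} {j} eq =
      subst T (sym (vlookup∘tabulate _ a)) (does⁺ (hit? c (i , a)) (j , eq))

    -- Each colour used in class `i` has exactly one owner by injectivity, and each item of class
    -- `i` owns one; so the image is as large as the fibre.
    size-image : (s : Selection) (i : Fin g) → size (image (proj₁ s) i) ≡ mult i
    size-image (c , c-class , c-inj) i =
      enumeration-unique (members-enumeration (image c i))
        (pullback {_≈′_ = _≡_ on proj₁} owner owner-cong owner-inj owner-surj (fibres i))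
      where
      owner : Members (image c i) → Fibre i
      owner (a , t) = let j , eq = ∈-image⁻ c t in j , trans (sym (c-class j)) (cong proj₁ eq)
      owner-cong : ∀ {u v} → proj₁ u ≡ proj₁ v → proj₁ (owner u) ≡ proj₁ (owner v)
      owner-cong {a , s} {_ , t} refl = c-inj (trans (proj₂ (∈-image⁻ c s)) (sym (proj₂ (∈-image⁻ c t))))
      owner-inj : ∀ {u v} → proj₁ (owner u) ≡ proj₁ (owner v) → proj₁ u ≡ proj₁ v
      owner-inj {a , s} {b , t} eq = ,-injectiveʳ
        (trans (sym (proj₂ (∈-image⁻ c s))) (trans (cong c eq) (proj₂ (∈-image⁻ c t))))
      owner-surj : ∀ f → ∃ λ u → proj₁ (owner u) ≡ proj₁ f
      owner-surj (j , eq) = (a , ∈-image⁺ c cj) , c-inj (trans (proj₂ (∈-image⁻ c (∈-image⁺ c cj))) (sym cj))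
        where
        colour : (κ : Key) → proj₁ κ ≡ i → ∃ λ a → κ ≡ (i , a)
        colour (_ , a) refl = a , refl
        a : Fin (d i)
        a = proj₁ (colour (c j) (trans (c-class j) eq))
        cj : c j ≡ (i , a)
        cj = proj₂ (colour (c j) (trans (c-class j) eq))

    images : Selection → ∀ i → Sized (d i) (mult i)
    images s i = image (proj₁ s) i , size-image s i

    images-cong : ∀ {s s′} → s ~ s′ → ∀ i → image (proj₁ s) i ≡ image (proj₁ s′) i
    images-cong {c , _} {c′ , _} (σ , eq) i = tabulate-cong λ a → does-⇔
      (mk⇔ (λ { (j , e) → to σ j , trans (eq j) e })
           (λ { (j , e) → from σ j , trans (sym (eq (from σ j))) (trans (cong c′ (strictlyInverseˡ σ j)) e) }))
      (hit? c (i , a)) (hit? c′ (i , a))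

    -- Both selections are injective with the same keys in use, so sending an item to the one with
    -- the same key on the other side is a bijection.
    images-inj : ∀ {s s′} → (∀ i → image (proj₁ s) i ≡ image (proj₁ s′) i) → s ~ s′
    images-inj {c , _ , c-inj} {c′ , _ , c′-inj} eq = mk↔ₛ′ f b
        (λ j → c′-inj (trans (f-eq (b j)) (b-eq j)))
        (λ j → c-inj (trans (b-eq (f j)) (f-eq j)))
      , f-eq
      where
      forth : ∀ j → ∃ λ l → c′ l ≡ c j
      forth j = ∈-image⁻ c′ (subst (λ p → T (vlookup p (proj₂ (c j)))) (eq (proj₁ (c j))) (∈-image⁺ c refl))
      back : ∀ j → ∃ λ l → c l ≡ c′ j
      back j = ∈-image⁻ c (subst (λ p → T (vlookup p (proj₂ (c′ j)))) (sym (eq (proj₁ (c′ j)))) (∈-image⁺ c′ refl))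
      f b : Fin m → Fin m
      f = proj₁ ∘ forth
      b = proj₁ ∘ back
      f-eq : ∀ j → c′ (f j) ≡ c j
      f-eq = proj₂ ∘ forth
      b-eq : ∀ j → c (b j) ≡ c′ j
      b-eq = proj₂ ∘ back

    -- The items of class `i` and the members of the prescribed subset are both numbered by
    -- `Fin (mult i)`; items receive the colour with the same number.
    images-surj : (p : ∀ i → Sized (d i) (mult i)) → ∃ λ (s : Selection) → ∀ i → image (proj₁ s) i ≡ proj₁ (p i)
    images-surj p = (c , (λ _ → refl) , λ {j} {l} → at-inj (j , refl) (l , refl)) , image≡
      where
      members : ∀ i → Enumeration {Members (proj₁ (p i))} (_≡_ on proj₁) (mult i)
      members i = subst (Enumeration _) (proj₂ (p i)) (members-enumeration (proj₁ (p i)))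
      at : ∀ {i} → Fibre i → Members (proj₁ (p i))
      at {i} u = rep (members i) (index (fibres i) u)
      c : Fin m → Key
      c j = class j , proj₁ (at (j , refl))
      -- Two independent class variables are used because the equation `class j ≡ class l` itself
      -- could not be matched against `refl`.
      at-inj : ∀ {i i′} (u : Fibre i) (u′ : Fibre i′) →
               (Key ∋ (i , proj₁ (at u))) ≡ (i′ , proj₁ (at u′)) → proj₁ u ≡ proj₁ u′
      at-inj u u′ eq with cong proj₁ eq
      ... | refl = index-inj (fibres _) (trans (sym (index-rep (members _) _))
                     (trans (index-cong (members _) (,-injectiveʳ eq)) (index-rep (members _) _)))
      c-at : ∀ {i} (u : Fibre i) → c (proj₁ u) ≡ (i , proj₁ (at u))
      c-at (j , refl) = refl
      chosen : ∀ κ j → c j ≡ κ → T (vlookup (proj₁ (p (proj₁ κ))) (proj₂ κ))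
      chosen _ j refl = proj₂ (at (j , refl))
      choose : ∀ i a → T (vlookup (proj₁ (p i)) a) → ∃ λ j → c j ≡ (i , a)
      choose i a t = proj₁ u , trans (c-at u) (cong (i ,_) (index-inj (members i)
          (trans (index-rep (members i) _) (index-rep (fibres i) _))))
        where
        u : Fibre i
        u = rep (fibres i) (index (members i) (a , t))
      image≡ : ∀ i → image c i ≡ proj₁ (p i)
      image≡ i = trans
        (tabulate-cong λ a → does-⇔ (mk⇔ (λ { (j , eq) → chosen (i , a) j eq }) (choose i a))
                                     (hit? c (i , a)) (T? (vlookup (proj₁ (p i)) a)))
        (tabulate∘lookup (proj₁ (p i)))

    selection-enumeration : Enumeration _~_ (product (tabulate λ i → d i C mult i))
    selection-enumeration = pullback {_≈′_ = λ p q → ∀ i → proj₁ (p i) ≡ proj₁ (q i)} images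
      (λ {s} {s′} → images-cong {s} {s′}) (λ {s} {s′} → images-inj {s} {s′}) images-surj
      (Π-enumeration g λ i → sized-enumeration (d i) (mult i))

-- Lists of labelings as class counts

-- `labelings` contains every labeling only up to pointwise equality; hence the requirements that
-- `_≈_` contain `_≗_` and that `P` respect it.
labeling-enumeration :
  (X : Graph) (k : ℕ) {_≈_ : Labeling X k → Labeling X k → Set} {P : Labeling X k → Set} →
  (≈-equiv : IsEquivalence _≈_) → (∀ {φ ψ} → φ ≗ ψ → φ ≈ ψ) → (∀ {φ ψ} → φ ≗ ψ → P φ → P ψ) →
  (_≈?_ : ∀ φ ψ → Dec (φ ≈ ψ)) (P? : ∀ φ → Dec (P φ)) →
  Enumeration {Σ (Labeling X k) P} (_≈_ on proj₁)
    (length (deduplicate _≈?_ (filter P? (labelings X k))))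
labeling-enumeration X k {_≈_} {P} ≈-equiv ≗⇒≈ P-resp _≈?_ P? = list-enumeration ≈-equiv _
  (all-deduplicate⁺ _≈?_ (all-filter P? (labelings X k)))
  (deduplicate-! (record { isDecEquivalence = record { isEquivalence = ≈-equiv ; _≟_ = _≈?_ } })
                 (filter P? (labelings X k)))
  λ φ p → any-deduplicate⁺ _≈?_ (λ s r → ≈-trans r (≈-sym s))
    (map-Any (λ { refl → ≗⇒≈ (code≗ φ) })
      (∈-filter⁺ P? (∈-tabulate⁺ {f = decode F K} (encode F K φ)) (P-resp (code≗ φ) p)))
  where
  open IsEquivalence ≈-equiv renaming (sym to ≈-sym; trans to ≈-trans)
  F : Finite (V X)
  F = finite X
  K : Finite (Fin k)
  K = k , ↔-id (Fin k)
  code≗ : ∀ φ → φ ≗ decode F K (encode F K φ)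
  code≗ φ v = sym (decode-encode F K φ v)

module _ {X : Graph} {k : ℕ} (Γ : Subgroup X) where

  Equivalent-isEquivalence : IsEquivalence (Equivalent {X} {k} Γ)
  Equivalent-isEquivalence = record
    { refl  = idAut X , Subgroup.id∈ Γ , λ _ → refl
    ; sym   = λ { {φ} {ψ} (π , π∈ , eq) → invAut π , Subgroup.inv∈ Γ {π} π∈
                , λ v → trans (sym (eq _)) (cong ψ (strictlyInverseˡ (Iso.bij π) v)) }
    ; trans = λ { (π , π∈ , p) (ρ , ρ∈ , q) → ρ ∘ᴬ π , Subgroup.∘∈ Γ {ρ} {π} ρ∈ π∈
                , λ v → trans (q _) (p v) }
    }

  D-enumeration : Enumeration {Σ (Labeling X k) (Distinguishing Γ)} (Equivalent Γ on proj₁) (D X k Γ)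
  D-enumeration = labeling-enumeration X k Equivalent-isEquivalence
    (λ eq → idAut X , Subgroup.id∈ Γ , λ v → sym (eq v))
    (λ eq dist π π∈ pres → dist π π∈ λ v → trans (eq _) (trans (pres v) (sym (eq v))))
    (equivalent? Γ) (distinguishing? Γ)

-- Labelings away from the roots

-- The roots are the vertices carrying a tag.
record Tagged : Set₁ where
  constructor tagged
  field
    body    : Graph
    tag     : V body → Maybe Bool
    tag-inj : ∀ {u v t} → tag u ≡ just t → tag v ≡ just t → u ≡ v

open Tagged public

record TaggedIso (X Y : Tagged) : Set where
  constructor taggedIso
  field
    iso     : Iso (body X) (body Y)
    tag-iso : ∀ v → tag Y (⟦ iso ⟧ v) ≡ tag X v

  inverse : V (body Y) → V (body X)
  inverse = from (Iso.bij iso)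

  iso-inverse : ∀ v → ⟦ iso ⟧ (inverse v) ≡ v
  iso-inverse = strictlyInverseˡ (Iso.bij iso)

  inverse-iso : ∀ v → inverse (⟦ iso ⟧ v) ≡ v
  inverse-iso = strictlyInverseʳ (Iso.bij iso)

open TaggedIso public

⟪_⟫ : ∀ {X Y} → TaggedIso X Y → V (body X) → V (body Y)
⟪ f ⟫ = ⟦ iso f ⟧

taggedId : ∀ {X} → TaggedIso X X
taggedId {X} = taggedIso (idAut (body X)) λ _ → refl

taggedSym : ∀ {X Y} → TaggedIso X Y → TaggedIso Y X
taggedSym {X} {Y} f = taggedIso
  (mkIso (↔-sym (Iso.bij (iso f))) λ u v →
    trans (sym (Iso.preserves (iso f) _ _)) (cong₂ (adj (body Y)) (iso-inverse f u) (iso-inverse f v)))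
  λ v → trans (sym (tag-iso f _)) (cong (tag Y) (iso-inverse f v))

taggedTrans : ∀ {X Y Z} → TaggedIso X Y → TaggedIso Y Z → TaggedIso X Z
taggedTrans f g = taggedIso
  (mkIso (Iso.bij (iso g) ↔-∘ Iso.bij (iso f)) λ u v →
    trans (Iso.preserves (iso g) _ _) (Iso.preserves (iso f) u v))
  λ v → trans (tag-iso g _) (tag-iso f v)

Matches : ∀ {X Y k} → TaggedIso X Y → Labeling (body X) k → Labeling (body Y) k → Set
Matches {X} f φ ψ = ∀ v → tag X v ≡ nothing → ψ (⟪ f ⟫ v) ≡ φ v

LabelIso : ∀ X Y {k} → Labeling (body X) k → Labeling (body Y) k → Set
LabelIso X Y φ ψ = Σ (TaggedIso X Y) λ f → Matches f φ ψ

Rigid : ∀ X {k} → Labeling (body X) k → Set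
Rigid X φ = ∀ (π : TaggedIso X X) → Matches π φ φ → ⟪ π ⟫ ≗ id

labelId : ∀ {X k} {φ ψ : Labeling (body X) k} → (∀ v → tag X v ≡ nothing → ψ v ≡ φ v) → LabelIso X X φ ψ
labelId eq = taggedId , eq

labelSym : ∀ {X Y k} {φ : Labeling (body X) k} {ψ : Labeling (body Y) k} →
           LabelIso X Y φ ψ → LabelIso Y X ψ φ
labelSym {φ = φ} {ψ} (f , eq) = taggedSym f , λ v none →
  trans (sym (eq _ (trans (tag-iso (taggedSym f) v) none))) (cong ψ (iso-inverse f v))

labelTrans : ∀ {X Y Z k} {φ : Labeling (body X) k} {ψ : Labeling (body Y) k} {χ : Labeling (body Z) k} →
             LabelIso X Y φ ψ → LabelIso Y Z ψ χ → LabelIso X Z φ χ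
labelTrans (f , p) (g , q) = taggedTrans f g , λ v none →
  trans (q _ (trans (tag-iso f v) none)) (p v none)

-- A label-preserving automorphism of `Y`, conjugated by `f`, is one of `X`, hence trivial.
Rigid-transport : ∀ {X Y k} {φ : Labeling (body X) k} {ψ : Labeling (body Y) k} →
                  LabelIso X Y φ ψ → Rigid X φ → Rigid Y ψ
Rigid-transport {φ = φ} {ψ} (f , p) rigid π q v =
  trans (cong ⟪ π ⟫ (sym (iso-inverse f v)))
    (trans (sym (iso-inverse f _))
      (trans (cong ⟪ f ⟫ (rigid (proj₁ conjugate) (proj₂ conjugate) (inverse f v))) (iso-inverse f v)))
  where
  conjugate : LabelIso _ _ φ φ
  conjugate = labelTrans {φ = φ} {ψ} {φ} (f , p)
    (labelTrans {φ = ψ} {ψ} {φ} (π , q) (labelSym {φ = φ} {ψ} (f , p)))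

tag-cases : (t : Maybe Bool) → t ≡ nothing ⊎ ∃ λ b → t ≡ just b
tag-cases nothing = inj₁ refl
tag-cases (just b) = inj₂ (b , refl)

module _ (X : Tagged) where

  TagStab : Subgroup (body X)
  TagStab = record
    { Member = λ π → ∀ v → tag X (⟦ π ⟧ v) ≡ tag X v
    ; ∈?     = λ π → all-finite? (finite (body X)) λ v → Maybe-≡-dec _≟ᵇ_ _ _
    ; ∈-resp = λ eq p v → trans (cong (tag X) (sym (eq v))) (p v)
    ; id∈    = λ _ → refl
    ; ∘∈     = λ p q v → trans (p _) (q v)
    ; inv∈   = λ {π} p v → trans (sym (p _)) (cong (tag X) (strictlyInverseˡ (Iso.bij π) v))
    }

  module _ {k : ℕ} where

    -- Tags are unique, so a tag-preserving automorphism fixes each root, and the labels there are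
    -- preserved whatever they are.
    matches⇒preserves : ∀ {φ : Labeling (body X) k} (π : TaggedIso X X) →
                        Matches π φ φ → Preserves (iso π) φ
    matches⇒preserves {φ} π eq v with tag-cases (tag X v)
    ... | inj₁ none       = eq v none
    ... | inj₂ (t , some) = cong φ (tag-inj X (trans (tag-iso π v) some) some)

    distinguishing⇒rigid : ∀ {φ : Labeling (body X) k} → Distinguishing TagStab φ → Rigid X φ
    distinguishing⇒rigid dist π eq = dist (iso π) (tag-iso π) (matches⇒preserves π eq)

    rigid⇒distinguishing : ∀ {φ : Labeling (body X) k} → Rigid X φ → Distinguishing TagStab φ
    rigid⇒distinguishing rigid π π∈ pres = rigid (taggedIso π π∈) λ v _ → pres v

    rigid? : (φ : Labeling (body X) k) → Dec (Rigid X φ)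
    rigid? φ = map′ distinguishing⇒rigid rigid⇒distinguishing (distinguishing? TagStab φ)

    labelIso? : (φ ψ : Labeling (body X) k) → Dec (LabelIso X X φ ψ)
    labelIso? φ ψ = map′
      (λ { (π , π∈ , eq) → taggedIso π π∈ , eq })
      (λ { (π , eq) → iso π , tag-iso π , eq })
      (anyAut? (body X)
        (λ { {π} {ρ} e (π∈ , eq) → Subgroup.∈-resp TagStab {π} {ρ} e π∈
                                 , λ v none → trans (cong ψ (sym (e v))) (eq v none) })
        λ π → Subgroup.∈? TagStab π ×-dec
          all-finite? (finite (body X)) λ v → Maybe-≡-dec _≟ᵇ_ (tag X v) nothing →-dec (_ ≟ᶠ _))

    labelIso-isEquivalence : IsEquivalence (LabelIso X X {k})
    labelIso-isEquivalence = record
      { refl  = λ {φ} → labelId {φ = φ} λ _ _ → refl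
      ; sym   = λ {φ} {ψ} → labelSym {φ = φ} {ψ}
      ; trans = λ {φ} {ψ} {χ} → labelTrans {φ = φ} {ψ} {χ}
      }

  abstract
    -- Kept opaque: `rigid-enumeration` already determines this number, and nothing else about it is
    -- used.
    rigidCount : ℕ → ℕ
    rigidCount k = length (deduplicate labelIso? (filter rigid? (labelings (body X) k)))

    rigid-enumeration : ∀ k → Enumeration {Σ (Labeling (body X) k) (Rigid X)} (LabelIso X X on proj₁) (rigidCount k)
    rigid-enumeration k = labeling-enumeration (body X) k labelIso-isEquivalence ≗⇒labelIso
      (λ {φ} {ψ} eq → Rigid-transport {φ = φ} {ψ} (≗⇒labelIso eq)) labelIso? rigid?
      where
      ≗⇒labelIso : ∀ {φ ψ : Labeling (body X) k} → φ ≗ ψ → LabelIso X X φ ψ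
      ≗⇒labelIso {φ} {ψ} eq = labelId {φ = φ} λ v _ → sym (eq v)

  fixes-roots : ∀ π → Member TagStab π → ∀ v → tag X v ≢ nothing → ⟦ π ⟧ v ≡ v
  fixes-roots π π∈ v some with tag-cases (tag X v)
  ... | inj₁ none = contradiction none some
  ... | inj₂ (b , eq) = tag-inj X (trans (π∈ v) eq) eq

  -- The delicate case is an untagged `v` sent to a root. That root is its own image, so injectivity
  -- makes it equal to `v`.
  fixes-roots⁻ : ∀ π → (∀ v → tag X v ≢ nothing → ⟦ π ⟧ v ≡ v) → Member TagStab π
  fixes-roots⁻ π fix v with tag-cases (tag X (⟦ π ⟧ v)) | tag-cases (tag X v)
  ... | _ | inj₂ (b , some) = cong (tag X) (fix v λ none → contradiction (trans (sym some) none) λ ())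
  ... | inj₁ none | inj₁ none′ = trans none (sym none′)
  ... | inj₂ (b , some) | inj₁ _ = cong (tag X) (Injection.injective (↔⇒↣ (Iso.bij π))
    (fix (⟦ π ⟧ v) λ none → contradiction (trans (sym some) none) λ ()))

  -- The group fixes the roots, so their labels can be chosen freely.
  D≡k^n*rigidCount :
    ∀ k {n} (root : Fin n → V (body X)) → Injective _≡_ _≡_ root →
    (∀ i → tag X (root i) ≢ nothing) → (∀ v → tag X v ≢ nothing → ∃ λ i → root i ≡ v) →
    (Γ : Subgroup (body X)) → (∀ π → Member Γ π → ∀ i → ⟦ π ⟧ (root i) ≡ root i) →
    (∀ π → (∀ i → ⟦ π ⟧ (root i) ≡ root i) → Member Γ π) →
    D (body X) k Γ ≡ k ^ n * rigidCount k
  D≡k^n*rigidCount k {n} root root-inj root-tagged tagged-root Γ Γ⇒fix fix⇒Γ =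
    enumeration-unique (D-enumeration Γ)
      (pullback {_≈′_ = _≗_ ≈× (LabelIso X X on proj₁)} split
        (λ { {φ , _} {ψ , _} → split-cong φ ψ }) (λ { {φ , _} {ψ , _} → split-inj φ ψ }) split-surj
        (×-enumeration (function-enumeration n k) (rigid-enumeration k)))
    where
    Γ⇒tag : ∀ π → Member Γ π → Member TagStab π
    Γ⇒tag π π∈ = fixes-roots⁻ π λ v some → fixed (tagged-root v some)
      where
      fixed : ∀ {v} → (∃ λ i → root i ≡ v) → ⟦ π ⟧ v ≡ v
      fixed (i , refl) = Γ⇒fix π π∈ i
    tag⇒Γ : ∀ π → Member TagStab π → Member Γ π
    tag⇒Γ π π∈ = fix⇒Γ π λ i → fixes-roots π π∈ (root i) (root-tagged i)

    ⇒rigid : ∀ {φ : Labeling (body X) k} → Distinguishing Γ φ → Rigid X φ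
    ⇒rigid dist = distinguishing⇒rigid λ π π∈ → dist π (tag⇒Γ π π∈)

    split : Σ (Labeling (body X) k) (Distinguishing Γ) → (Fin n → Fin k) × Σ (Labeling (body X) k) (Rigid X)
    split (φ , dist) = φ ∘ root , φ , ⇒rigid dist

    split-cong : ∀ φ ψ → Equivalent Γ φ ψ → φ ∘ root ≗ ψ ∘ root × LabelIso X X φ ψ
    split-cong φ ψ (π , π∈ , eq) =
        (λ i → trans (sym (eq (root i))) (cong ψ (Γ⇒fix π π∈ i)))
      , taggedIso π (Γ⇒tag π π∈) , λ v _ → eq v

    split-inj : ∀ φ ψ → φ ∘ root ≗ ψ ∘ root × LabelIso X X φ ψ → Equivalent Γ φ ψ
    split-inj φ ψ (same , π , eq) = iso π , tag⇒Γ (iso π) (tag-iso π) , labels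
      where
      labels : ∀ v → ψ (⟪ π ⟫ v) ≡ φ v
      labels v with tag-cases (tag X v)
      ... | inj₁ none = eq v none
      ... | inj₂ (b , some) with tagged-root v (λ none → contradiction (trans (sym some) none) λ ())
      ...   | i , refl = trans (cong ψ (fixes-roots (iso π) (tag-iso π) (root i) (root-tagged i))) (sym (same i))

    split-surj : ∀ p → ∃ λ q → (_≗_ ≈× (LabelIso X X on proj₁)) (split q) p
    split-surj (ℓ , ψ , rigid) =
        (φ , λ π π∈ → rigid⇒distinguishing (Rigid-transport {φ = ψ} {φ} (labelId {φ = ψ} away) rigid) π (Γ⇒tag π π∈))
      , at-root , labelId {φ = φ} {ψ} (λ v none → sym (away v none))
      where
      override : ∀ v → tag X v ≡ nothing ⊎ (∃ λ b → tag X v ≡ just b) → Fin k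
      override v (inj₁ _) = ψ v
      override v (inj₂ (b , some)) =
        ℓ (proj₁ (tagged-root v λ none → contradiction (trans (sym some) none) λ ()))
      φ : Labeling (body X) k
      φ v = override v (tag-cases (tag X v))
      away : ∀ v → tag X v ≡ nothing → φ v ≡ ψ v
      away v none with tag-cases (tag X v)
      ... | inj₁ _ = refl
      ... | inj₂ (b , some) = contradiction (trans (sym none) some) λ ()
      at-root : φ ∘ root ≗ ℓ
      at-root i with tag-cases (tag X (root i))
      ... | inj₁ none = contradiction none (root-tagged i)
      ... | inj₂ (b , some) = cong ℓ (root-inj (proj₂ (tagged-root (root i) _)))

-- Gluing along roots

T-extensional : ∀ {a b} → (T a → T b) → (T b → T a) → a ≡ b
T-extensional {false} {false} _ _ = refl
T-extensional {false} {true}  _ g = ⊥-elim (g tt)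
T-extensional {true}  {false} f _ = ⊥-elim (f tt)
T-extensional {true}  {true}  _ _ = refl

transpose-invariant : ∀ {n} {A : Set} (c : Fin n → A) i j → c i ≡ c j →
                      ∀ l → c l ≡ c (to (transpose i j) l)
transpose-invariant c i j eq l with l ≟ᶠ i
... | yes refl = eq
... | no _ with l ≟ᶠ j
...   | yes refl = sym eq
...   | no _ = refl

transpose-matches : ∀ {n} (i j : Fin n) → to (transpose i j) i ≡ j
transpose-matches i j with i ≟ᶠ i
... | yes _ = refl
... | no i≢i = contradiction refl i≢i

restrict : (G : Tagged) → Subgraph (body G) → Tagged
restrict G S = tagged ⌊ S ⌋ (tag G ∘ proj₁) λ p q → Σ-T-≡ (inV S) (tag-inj G p q)

restrictIso : ∀ {G} S S′ (π : TaggedIso G G) → MapsOnto (iso π) S S′ →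
              TaggedIso (restrict G S) (restrict G S′)
restrictIso S S′ π (onV , onE) = taggedIso
  (mkIso (mk↔ₛ′
      (λ { (v , v∈) → ⟪ π ⟫ v , subst T (sym (onV v)) v∈ })
      (λ { (w , w∈) → inverse π w
         , subst T (trans (cong (inV S′) (sym (iso-inverse π w))) (onV (inverse π w))) w∈ })
      (λ { (w , _) → Σ-T-≡ (inV S′) (iso-inverse π w) })
      (λ { (v , _) → Σ-T-≡ (inV S) (inverse-iso π v) }))
    (λ { (u , _) (v , _) → onE u v }))
  (λ { (v , _) → tag-iso π v })

-- What the count needs from a decomposition, without distinguishing arms from links. `distinct` is
-- asked only inside a class, since keys of different classes differ anyway. By `meet`, it concerns
-- pieces made of roots alone.
record Gluing (G : Tagged) {m g : ℕ} (H : Fin m → Subgraph (body G))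
              (class : Fin m → Fin g) (M : Fin g → Tagged) : Set where
  field
    cover-V  : ∀ v → ∃ λ j → v ∈ⱽ H j
    cover-E  : ∀ u v → T (adj (body G) u v) → ∃ λ j → T (inE (H j) u v)
    meet     : ∀ {j l v} → v ∈ⱽ H j → v ∈ⱽ H l → j ≢ l → tag G v ≢ nothing
    distinct : ∀ {j l} → j ≢ l → class j ≡ class l → ¬ SameSubgraph (H j) (H l)
    permuted : (π : TaggedIso G G) → Σ (Fin m ↔ Fin m) λ σ →
               ∀ j → MapsOnto (iso π) (H j) (H (to σ j)) × class (to σ j) ≡ class j
    chart    : ∀ j → TaggedIso (restrict G (H j)) (M (class j))

module _ {G : Tagged} {m g : ℕ} {H : Fin m → Subgraph (body G)}
         {class : Fin m → Fin g} {M : Fin g → Tagged} (gluing : Gluing G H class M) where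

  open Gluing gluing

  private
    P : Fin m → Tagged
    P j = restrict G (H j)

  P-≡ : ∀ {j} {u v : V (body (P j))} → proj₁ u ≡ proj₁ v → u ≡ v
  P-≡ {j} = Σ-T-≡ (inV (H j))

  root-fixed : ∀ {j l} (f : TaggedIso (P j) (P l)) v → tag (P j) v ≢ nothing → proj₁ (⟪ f ⟫ v) ≡ proj₁ v
  root-fixed {j} f v some with tag-cases (tag (P j) v)
  ... | inj₁ none = contradiction none some
  ... | inj₂ (b , eq) = tag-inj G (trans (tag-iso f v) eq) eq

  fixed⇒same : ∀ {j l} (f : TaggedIso (P j) (P l)) → (∀ v → proj₁ (⟪ f ⟫ v) ≡ proj₁ v) →
               SameSubgraph (H j) (H l)
  fixed⇒same {j} {l} f fixed =
      (λ v → T-extensional (forth v) (back v))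
    , (λ u v → T-extensional
        (λ e → let u∈ = left j e ; v∈ = right j e in
          subst T (trans (sym (Iso.preserves (iso f) (u , u∈) (v , v∈)))
                         (cong₂ (inE (H l)) (fixed (u , u∈)) (fixed (v , v∈)))) e)
        (λ e → let u∈ = back u (left l e) ; v∈ = back v (right l e) in
          subst T (trans (sym (cong₂ (inE (H l)) (fixed (u , u∈)) (fixed (v , v∈))))
                         (Iso.preserves (iso f) (u , u∈) (v , v∈))) e))
    where
    left : ∀ j {u v} → T (inE (H j) u v) → u ∈ⱽ H j
    left j = Subgraph.inE⇒inV (H j) _ _
    right : ∀ j {u v} → T (inE (H j) u v) → v ∈ⱽ H j
    right j e = left j (subst T (Subgraph.inE-sym (H j) _ _) e)
    forth : ∀ v → v ∈ⱽ H j → v ∈ⱽ H l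
    forth v v∈ = subst (_∈ⱽ H l) (fixed (v , v∈)) (proj₂ (⟪ f ⟫ (v , v∈)))
    back : ∀ v → v ∈ⱽ H l → v ∈ⱽ H j
    back v v∈ = subst (_∈ⱽ H j)
      (trans (sym (fixed (inverse f (v , v∈)))) (cong proj₁ (iso-inverse f (v , v∈))))
      (proj₂ (inverse f (v , v∈)))

  -- Automorphisms glued from isomorphisms between the pieces

  module _ (σ : Fin m ↔ Fin m) (f : ∀ j → TaggedIso (P j) (P (to σ j))) where

    glue : V (body G) → V (body G)
    glue v = proj₁ (⟪ f (proj₁ (cover-V v)) ⟫ (v , proj₂ (cover-V v)))

    -- The value does not depend on the piece chosen by `cover-V`: a vertex in two pieces is a root,
    -- and every `f j` leaves roots in place.
    glue-on : ∀ j v (v∈ : v ∈ⱽ H j) → glue v ≡ proj₁ (⟪ f j ⟫ (v , v∈))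
    glue-on j v v∈ with cover-V v
    ... | l , v∈l with l ≟ᶠ j
    ...   | yes refl = cong (proj₁ ∘ ⟪ f j ⟫) (P-≡ refl)
    ...   | no l≢j = trans (root-fixed (f l) _ some) (sym (root-fixed (f j) _ some))
      where
      some : tag G v ≢ nothing
      some = meet v∈l v∈ l≢j

    unglue-on : ∀ l w → w ∈ⱽ H l → ∃ λ j → ∃ λ v → Σ (v ∈ⱽ H j) λ v∈ → to σ j ≡ l × proj₁ (⟪ f j ⟫ (v , v∈)) ≡ w
    unglue-on l w w∈ = pull (from σ l) (strictlyInverseˡ σ l) w∈
      where
      -- The target of `f j` is `P (to σ j)`, whereas `w` lies in `H l`; with `l` a variable the
      -- equation between them can be matched.
      pull : ∀ {l} j → to σ j ≡ l → w ∈ⱽ H l →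
             ∃ λ j → ∃ λ v → Σ (v ∈ⱽ H j) λ v∈ → to σ j ≡ l × proj₁ (⟪ f j ⟫ (v , v∈)) ≡ w
      pull j refl w∈ = j , _ , proj₂ (inverse (f j) (w , w∈)) , refl , cong proj₁ (iso-inverse (f j) (w , w∈))

    unglue : V (body G) → V (body G)
    unglue w = proj₁ (proj₂ (unglue-on _ w (proj₂ (cover-V w))))

    glue-unglue : ∀ w → glue (unglue w) ≡ w
    glue-unglue w with unglue-on _ w (proj₂ (cover-V w))
    ... | j , v , v∈ , _ , eq = trans (glue-on j v v∈) eq

    glue-tag : ∀ v → tag G (glue v) ≡ tag G v
    glue-tag v = tag-iso (f _) _

    -- For `u` and `v` taken from different pieces, the common image lies in two different pieces
    -- and is a root. Tags are preserved, so `u` and `v` are roots too, and roots do not move.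
    glue-injective : ∀ {u v} → glue u ≡ glue v → u ≡ v
    glue-injective {u} {v} eq with proj₁ (cover-V u) ≟ᶠ proj₁ (cover-V v)
    ... | yes same = within same (proj₂ (cover-V u)) (proj₂ (cover-V v))
      where
      within : ∀ {j l} → j ≡ l → u ∈ⱽ H j → v ∈ⱽ H l → u ≡ v
      within {j} refl u∈ v∈ = cong proj₁ (trans (sym (inverse-iso (f j) (u , u∈)))
        (trans (cong (inverse (f j)) (P-≡ (trans (sym (glue-on j u u∈)) (trans eq (glue-on j v v∈)))))
               (inverse-iso (f j) (v , v∈))))
    ... | no different = trans (sym (fixed u some-u)) (trans eq (fixed v some-v))
      where
      fixed : ∀ w → tag G w ≢ nothing → glue w ≡ w
      fixed w = root-fixed (f (proj₁ (cover-V w))) (w , proj₂ (cover-V w))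
      some : tag G (glue u) ≢ nothing
      some = meet (proj₂ (⟪ f _ ⟫ (u , proj₂ (cover-V u))))
                  (subst (_∈ⱽ H _) (sym eq) (proj₂ (⟪ f _ ⟫ (v , proj₂ (cover-V v)))))
                  (different ∘ Injection.injective (↔⇒↣ σ))
      some-u : tag G u ≢ nothing
      some-u none = some (trans (glue-tag u) none)
      some-v : tag G v ≢ nothing
      some-v none = some (trans (cong (tag G) eq) (trans (glue-tag v) none))

    glue-edge : ∀ u v → T (adj (body G) u v) → T (adj (body G) (glue u) (glue v))
    glue-edge u v e with cover-E u v e
    ... | j , e∈ = Subgraph.inE⇒adj (H (to σ j)) _ _
        (subst T (trans (sym (Iso.preserves (iso (f j)) (u , u∈) (v , v∈)))
                        (cong₂ (inE (H (to σ j))) (sym (glue-on j u u∈)) (sym (glue-on j v v∈)))) e∈)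
      where
      u∈ : u ∈ⱽ H j
      u∈ = Subgraph.inE⇒inV (H j) u v e∈
      v∈ : v ∈ⱽ H j
      v∈ = Subgraph.inE⇒inV (H j) v u (subst T (Subgraph.inE-sym (H j) u v) e∈)

    glue-edge⁻ : ∀ u v → T (adj (body G) (glue u) (glue v)) → T (adj (body G) u v)
    glue-edge⁻ u v e with cover-E _ _ e
    ... | l , e∈ = pull (from σ l) (strictlyInverseˡ σ l) e∈
      where
      pull : ∀ {l} j → to σ j ≡ l → T (inE (H l) (glue u) (glue v)) → T (adj (body G) u v)
      pull j refl e∈ = subst₂ (λ a b → T (adj (body G) a b)) (back u u∈) (back v v∈)
          (Subgraph.inE⇒adj (H j) _ _
            (subst T (sym (Iso.preserves (iso (taggedSym (f j))) (glue u , u∈) (glue v , v∈))) e∈))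
        where
        u∈ : glue u ∈ⱽ H (to σ j)
        u∈ = Subgraph.inE⇒inV (H (to σ j)) _ _ e∈
        v∈ : glue v ∈ⱽ H (to σ j)
        v∈ = Subgraph.inE⇒inV (H (to σ j)) _ _ (subst T (Subgraph.inE-sym (H (to σ j)) _ _) e∈)
        -- `glue w` may have been computed in a piece other than `H j`, so the inverse of `f j` is
        -- cancelled through injectivity of `glue`.
        back : ∀ w (w∈ : glue w ∈ⱽ H (to σ j)) → proj₁ (inverse (f j) (glue w , w∈)) ≡ w
        back w w∈ = glue-injective (trans (glue-on j _ (proj₂ (inverse (f j) (glue w , w∈))))
          (cong proj₁ (iso-inverse (f j) (glue w , w∈))))

    glued : TaggedIso G G
    glued = taggedIso
      (mkIso (mk↔ₛ′ glue unglue glue-unglue (λ v → glue-injective (glue-unglue (glue v))))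
             (λ u v → T-extensional (glue-edge⁻ u v) (glue-edge u v)))
      glue-tag

  -- Rigid labelings of a glued graph as selections of keys

  module _ {k : ℕ} where

    res : ∀ j → Labeling (body G) k → Labeling (body (P j)) k
    res j φ = φ ∘ proj₁

    glued-matches : ∀ φ ψ σ (f : ∀ j → LabelIso (P j) (P (to σ j)) (res j φ) (res (to σ j) ψ)) →
                    Matches (glued σ (proj₁ ∘ f)) φ ψ
    glued-matches φ ψ σ f v none = proj₂ (f _) (v , _) none

    restrict-matches : ∀ φ ψ j l (π : TaggedIso G G) (onto : MapsOnto (iso π) (H j) (H l)) →
                       Matches π φ ψ → Matches (restrictIso (H j) (H l) π onto) (res j φ) (res l ψ)
    restrict-matches φ ψ j l π onto eq (v , _) = eq v

    -- An automorphism of one piece extends to `G` by the identity on all other pieces.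
    res-rigid : ∀ φ → Rigid G φ → ∀ j → Rigid (P j) (res j φ)
    res-rigid φ rigid j π eq u@(v , v∈) = P-≡
      (trans (sym (trans (glue-on (↔-id _) (proj₁ ∘ f) j v v∈) (cong proj₁ (f-at (j ≟ᶠ j)))))
             (rigid (glued (↔-id _) (proj₁ ∘ f)) (glued-matches φ φ (↔-id _) f) v))
      where
      extend : ∀ l → Dec (l ≡ j) → LabelIso (P l) (P l) (res l φ) (res l φ)
      extend l (yes refl) = π , eq
      extend l (no _) = labelId {φ = res l φ} λ _ _ → refl
      f : ∀ l → LabelIso (P l) (P l) (res l φ) (res l φ)
      f l = extend l (l ≟ᶠ j)
      f-at : ∀ d → ⟪ proj₁ (extend j d) ⟫ u ≡ ⟪ π ⟫ u
      f-at (yes refl) = refl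
      f-at (no j≢j) = contradiction refl j≢j

    open Selections class (λ i → rigidCount (M i) k)

    model-iso : ∀ {X Y} (h : TaggedIso X Y) (φ : Labeling (body X) k) → LabelIso X Y φ (φ ∘ inverse h)
    model-iso h φ = h , λ v _ → cong φ (inverse-iso h v)

    -- The labeling is carried to the model and replaced by the number of its class there. This is a
    -- complete invariant of the labeled piece: `code-cong` and `code-inj` are the two directions.
    code : ∀ i {X} → TaggedIso X (M i) → (φ : Labeling (body X) k) → Rigid X φ → Key
    code i h φ rigid = i , index (rigid-enumeration (M i) k)
      (φ ∘ inverse h , Rigid-transport {φ = φ} (model-iso h φ) rigid)

    code-cong : ∀ {i i′ X Y} (h : TaggedIso X (M i)) (h′ : TaggedIso Y (M i′)) φ ψ r r′ →
                i ≡ i′ → LabelIso X Y φ ψ → code i h φ r ≡ code i′ h′ ψ r′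
    code-cong {i} h h′ φ ψ r r′ refl f = cong (i ,_) (index-cong (rigid-enumeration (M i) k)
      (labelTrans {φ = φ ∘ inverse h} {φ} {ψ ∘ inverse h′} (labelSym {φ = φ} {φ ∘ inverse h} (model-iso h φ))
        (labelTrans {φ = φ} {ψ} {ψ ∘ inverse h′} f (model-iso h′ ψ))))

    code-inj : ∀ {i i′ X Y} (h : TaggedIso X (M i)) (h′ : TaggedIso Y (M i′)) φ ψ r r′ →
               code i h φ r ≡ code i′ h′ ψ r′ → LabelIso X Y φ ψ
    code-inj {i} h h′ φ ψ r r′ eq with cong proj₁ eq
    ... | refl = labelTrans {φ = φ} {φ ∘ inverse h} {ψ} (model-iso h φ)
      (labelTrans {φ = φ ∘ inverse h} {ψ ∘ inverse h′} {ψ}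
        (index-inj (rigid-enumeration (M i) k) (,-injectiveʳ eq))
        (labelSym {φ = ψ} {ψ ∘ inverse h′} (model-iso h′ ψ)))

    code-surj : ∀ {i X} (h : TaggedIso X (M i)) κ → proj₁ κ ≡ i →
                ∃ λ φ → Σ (Rigid X φ) λ r → code i h φ r ≡ κ
    code-surj {X = X} h (i , a) refl = φ , r , cong (i ,_) (trans
        (index-cong (rigid-enumeration (M i) k)
          (labelId {φ = φ ∘ inverse h} {ψ} λ v _ → sym (cong ψ (iso-inverse h v))))
        (index-rep (rigid-enumeration (M i) k) a))
      where
      ψ : Labeling (body (M i)) k
      ψ = proj₁ (rep (rigid-enumeration (M i) k) a)
      φ : Labeling (body X) k
      φ = ψ ∘ ⟪ h ⟫
      r : Rigid X φ
      r = Rigid-transport {φ = ψ} {φ} (labelSym {φ = φ} {ψ} (h , λ _ _ → refl))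
            (proj₂ (rep (rigid-enumeration (M i) k) a))

    keys : ∀ φ → (∀ j → Rigid (P j) (res j φ)) → Fin m → Key
    keys φ r j = code (class j) (chart j) (res j φ) (r j)

    keys-iso : ∀ φ ψ r r′ (σ : Fin m ↔ Fin m) → (∀ j → keys ψ r′ (to σ j) ≡ keys φ r j) →
               ∀ j → LabelIso (P j) (P (to σ j)) (res j φ) (res (to σ j) ψ)
    keys-iso φ ψ r r′ σ eq j = code-inj (chart j) (chart (to σ j)) (res j φ) (res (to σ j) ψ)
      (r j) (r′ (to σ j)) (sym (eq j))

    -- Equal keys give label isomorphisms `H j` to `H (to σ j)`. Glued together they preserve `φ`,
    -- so rigidity makes the result the identity, and none of them moves a vertex.
    keys-fixed : ∀ φ r → Rigid G φ → (σ : Fin m ↔ Fin m) → (∀ j → keys φ r (to σ j) ≡ keys φ r j) →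
                 ∀ j → SameSubgraph (H j) (H (to σ j))
    keys-fixed φ r rigid σ eq j = fixed⇒same (proj₁ (f j)) λ { (v , v∈) →
        trans (sym (glue-on σ (proj₁ ∘ f) j v v∈))
              (rigid (glued σ (proj₁ ∘ f)) (glued-matches φ φ σ f) v) }
      where
      f : ∀ j → LabelIso (P j) (P (to σ j)) (res j φ) (res (to σ j) φ)
      f = keys-iso φ φ r r σ eq

    -- The transposition of `j` and `l` moves only these two items, whose keys agree, so it
    -- preserves all keys.
    keys-same : ∀ φ (rigid : Rigid G φ) j l →
                keys φ (res-rigid φ rigid) j ≡ keys φ (res-rigid φ rigid) l → SameSubgraph (H j) (H l)
    keys-same φ rigid j l eq = subst (λ t → SameSubgraph (H j) (H t)) (transpose-matches j l)
      (keys-fixed φ (res-rigid φ rigid) rigid (transpose j l)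
        (λ t → sym (transpose-invariant (keys φ (res-rigid φ rigid)) j l eq t)) j)

    keys-injective : ∀ φ (rigid : Rigid G φ) → Injective _≡_ _≡_ (keys φ (res-rigid φ rigid))
    keys-injective φ rigid {j} {l} eq = decidable-stable (j ≟ᶠ l) λ j≢l →
      distinct j≢l (cong proj₁ eq) (keys-same φ rigid j l eq)

    keys-cong : ∀ φ ψ r r′ (π : TaggedIso G G) → Matches π φ ψ →
                let σ , _ = permuted π in ∀ j → keys ψ r′ (to σ j) ≡ keys φ r j
    keys-cong φ ψ r r′ π eq j = let σ , on = permuted π in
      sym (code-cong (chart j) (chart (to σ j)) (res j φ) (res (to σ j) ψ) (r j) (r′ (to σ j)) (sym (proj₂ (on j)))
            (restrictIso (H j) (H (to σ j)) π (proj₁ (on j)) , restrict-matches φ ψ j (to σ j) π (proj₁ (on j)) eq))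

    -- The permutation of pieces induced by `π` preserves keys, so injectivity makes it the
    -- identity. Thus `π` maps every piece onto itself and is trivial there.
    glue-rigid : ∀ φ (r : ∀ j → Rigid (P j) (res j φ)) → Injective _≡_ _≡_ (keys φ r) → Rigid G φ
    glue-rigid φ r inj π eq v = cong proj₁
        (r j (restrictIso (H j) (H j) π onto) (restrict-matches φ φ j j π onto eq) (v , proj₂ (cover-V v)))
      where
      j : Fin m
      j = proj₁ (cover-V v)
      onto : MapsOnto (iso π) (H j) (H j)
      onto = subst (MapsOnto (iso π) (H j) ∘ H) (inj (keys-cong φ φ r r π eq j)) (proj₁ (proj₂ (permuted π) j))

    select : Σ (Labeling (body G) k) (Rigid G) → Selection
    select (φ , rigid) = keys φ (res-rigid φ rigid) , (λ _ → refl) , keys-injective φ rigid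

    select-surj : ∀ s → ∃ λ φ → select φ ~ s
    select-surj (c , c-class , c-inj) =
      (φ , rigid) , ↔-id _ , λ j → sym (keys≡ (res-rigid φ rigid) j)
      where
      local : ∀ j → ∃ λ φ → Σ (Rigid (P j) φ) λ r → code (class j) (chart j) φ r ≡ c j
      local j = code-surj (chart j) (c j) (c-class j)
      -- Local labelings may disagree at the roots, where the choice made by `cover-V` decides. This
      -- does no harm, because `LabelIso` ignores root labels.
      φ : Labeling (body G) k
      φ v = proj₁ (local (proj₁ (cover-V v))) (v , proj₂ (cover-V v))
      φ-on : ∀ j v → tag (P j) v ≡ nothing → res j φ v ≡ proj₁ (local j) v
      φ-on j (v , v∈) none with cover-V v
      ... | l , v∈l with l ≟ᶠ j
      ...   | yes refl = cong (proj₁ (local j)) (P-≡ refl)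
      ...   | no l≢j = contradiction none (meet v∈l v∈ l≢j)
      r : ∀ j → Rigid (P j) (res j φ)
      r j = Rigid-transport {φ = proj₁ (local j)} {res j φ}
        (labelId {φ = proj₁ (local j)} (φ-on j)) (proj₁ (proj₂ (local j)))
      -- Needed for every family of rigidity proofs: `rigid` is built from the local `r`, while
      -- `select` then uses the family given by `res-rigid`.
      keys≡ : ∀ r j → keys φ r j ≡ c j
      keys≡ r j = trans
        (code-cong (chart j) (chart j) (res j φ) (proj₁ (local j)) (r j) (proj₁ (proj₂ (local j))) refl
          (labelId {φ = res j φ} λ v none → sym (φ-on j v none)))
        (proj₂ (proj₂ (local j)))
      rigid : Rigid G φ
      rigid = glue-rigid φ r λ {j} {l} eq → c-inj (trans (sym (keys≡ r j)) (trans eq (keys≡ r l)))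

    rigidCount-gluing : ∀ {mult : Fin g → ℕ} → (∀ i → Enumeration {Fibre i} (_≡_ on proj₁) (mult i)) →
                        rigidCount G k ≡ product (tabulate λ i → rigidCount (M i) k C mult i)
    rigidCount-gluing fibres = enumeration-unique (rigid-enumeration G k)
      (pullback {_≈′_ = _~_} select
        (λ { {φ , rφ} {ψ , rψ} (π , eq) → proj₁ (permuted π)
           , keys-cong φ ψ (res-rigid φ rφ) (res-rigid ψ rψ) π eq })
        (λ { {φ , rφ} {ψ , rψ} (σ , eq) →
           let f = keys-iso φ ψ (res-rigid φ rφ) (res-rigid ψ rψ) σ eq
           in glued σ (proj₁ ∘ f) , glued-matches φ ψ σ f })
        select-surj
        (selection-enumeration fibres))

-- Two-rooted graphs and arms

module _ {P Q : Set} where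

  pick : Dec P → Dec Q → Maybe Bool
  pick (yes _) _       = just true
  pick (no _)  (yes _) = just false
  pick (no _)  (no _)  = nothing

  pick-left : P → ∀ p? q? → pick p? q? ≢ nothing
  pick-left p (yes _) _ ()
  pick-left p (no ¬p) _ = contradiction p ¬p

  pick-right : Q → ∀ p? q? → pick p? q? ≢ nothing
  pick-right q (no _) (no ¬q) = contradiction q ¬q

  pick-true : ∀ p? q? → pick p? q? ≡ just true → P
  pick-true (yes p) _ _ = p
  pick-true (no _) (yes _) ()

  pick-false : ∀ p? q? → pick p? q? ≡ just false → Q
  pick-false (no _) (yes q) _ = q

  pick-some : ∀ p? q? → pick p? q? ≢ nothing → P ⊎ Q
  pick-some (yes p) _       _    = inj₁ p
  pick-some (no _)  (yes q) _    = inj₂ q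
  pick-some (no _)  (no _)  some = contradiction refl some

pick-⇔ : ∀ {P P′ Q Q′ : Set} → P ⇔ P′ → Q ⇔ Q′ →
         ∀ (p? : Dec P) (q? : Dec Q) (p′? : Dec P′) (q′? : Dec Q′) → pick p? q? ≡ pick p′? q′?
pick-⇔ P⇔ Q⇔ (yes p) _ (yes _) _ = refl
pick-⇔ P⇔ Q⇔ (yes p) _ (no ¬p′) _ = contradiction (Equivalence.to P⇔ p) ¬p′
pick-⇔ P⇔ Q⇔ (no ¬p) _ (yes p′) _ = contradiction (Equivalence.from P⇔ p′) ¬p
pick-⇔ P⇔ Q⇔ (no _) (yes _) (no _) (yes _) = refl
pick-⇔ P⇔ Q⇔ (no _) (yes q) (no _) (no ¬q′) = contradiction (Equivalence.to Q⇔ q) ¬q′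
pick-⇔ P⇔ Q⇔ (no _) (no ¬q) (no _) (yes q′) = contradiction (Equivalence.from Q⇔ q′) ¬q
pick-⇔ P⇔ Q⇔ (no _) (no _) (no _) (no _) = refl

module _ (X : Graph) (a b : V X) where

  private
    is : ∀ u v → Dec (u ≡ v)
    is = ≟-finite (finite X)

  tag₂ : V X → Maybe Bool
  tag₂ v = pick (is v a) (is v b)

  tag₂-root : ∀ v → tag₂ v ≢ nothing → v ≡ a ⊎ v ≡ b
  tag₂-root v = pick-some (is v a) (is v b)

  tag₂-a : tag₂ a ≢ nothing
  tag₂-a = pick-left refl (is a a) (is a b)

  tag₂-b : tag₂ b ≢ nothing
  tag₂-b = pick-right refl (is b a) (is b b)

  tag₂-injective : ∀ {u v t} → tag₂ u ≡ just t → tag₂ v ≡ just t → u ≡ v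
  tag₂-injective {u} {v} {true}  p q =
    trans (pick-true (is u a) (is u b) p) (sym (pick-true (is v a) (is v b) q))
  tag₂-injective {u} {v} {false} p q =
    trans (pick-false (is u a) (is u b) p) (sym (pick-false (is v a) (is v b) q))

  twoRoots : Tagged
  twoRoots = tagged X tag₂ tag₂-injective

  D₂≡k²*rigidCount : a ≢ b → ∀ k → D₂ X k a b ≡ k ^ 2 * rigidCount twoRoots k
  D₂≡k²*rigidCount a≢b k = D≡k^n*rigidCount twoRoots k root root-inj root-tagged tagged-root
    (Stab₂ X a b)
    (λ { π (p , q) zero → p ; π (p , q) (suc zero) → q })
    (λ π fix → fix zero , fix (suc zero))
    where
    root : Fin 2 → V X
    root zero       = a
    root (suc zero) = b
    root-inj : ∀ {i j} → root i ≡ root j → i ≡ j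
    root-inj {zero}     {zero}     _  = refl
    root-inj {zero}     {suc zero} eq = contradiction eq a≢b
    root-inj {suc zero} {zero}     eq = contradiction (sym eq) a≢b
    root-inj {suc zero} {suc zero} _  = refl
    root-tagged : ∀ i → tag₂ (root i) ≢ nothing
    root-tagged zero       = tag₂-a
    root-tagged (suc zero) = tag₂-b
    tagged-root : ∀ v → tag₂ v ≢ nothing → ∃ λ i → root i ≡ v
    tagged-root v some with tag₂-root v some
    ... | inj₁ eq = zero , sym eq
    ... | inj₂ eq = suc zero , sym eq

module _ {G : Graph} {x y : V G} where

  -- Tags on the link are decided in `G`, tags on `B` in `graph B`. The decisions agree because `f`
  -- is injective and sends roots to roots.
  rootedIso⇒taggedIso : ∀ (L : Link G x y) (B : BiRooted) → RootedIso (Link.rooted L) B →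
    TaggedIso (restrict (twoRoots G x y) (Link.sub L)) (twoRoots (graph B) (rootˣ B) (rootʸ B))
  rootedIso⇒taggedIso L B (f , fx , fy) = taggedIso f λ v →
    pick-⇔ (at-root (Link.x∈ L) fx v) (at-root (Link.y∈ L) fy v)
      (≟-finite (finite (graph B)) _ _) (≟-finite (finite (graph B)) _ _)
      (≟-finite (finite G) _ _) (≟-finite (finite G) _ _)
    where
    at-root : ∀ {z b} (z∈ : z ∈ⱽ Link.sub L) → ⟦ f ⟧ (z , z∈) ≡ b → ∀ v →
              (⟦ f ⟧ v ≡ b) ⇔ (proj₁ v ≡ z)
    at-root z∈ fz v = mk⇔
      (λ eq → cong proj₁ (Injection.injective (↔⇒↣ (Iso.bij f)) (trans eq (sym fz))))
      (λ eq → trans (cong ⟦ f ⟧ (Σ-T-≡ (inV (Link.sub L)) eq)) fz)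

module _ (G : Graph) (z w : V G) (z≢w : z ≢ w) where

  private
    is-z : ∀ v → Dec (v ≡ z)
    is-z v = ≟-finite (finite G) v z

  trivialArm : Arm G z w
  trivialArm = record
    { sub = record
      { inV     = λ v → does (is-z v)
      ; inE     = λ _ _ → false
      ; inE-sym = λ _ _ → refl
      ; inE⇒inV = λ _ _ ()
      ; inE⇒adj = λ _ _ ()
      }
    ; connected = λ { (u , u∈) (v , v∈) → subst (Star _ (u , u∈))
        (Σ-T-≡ (does ∘ is-z) (trans (does⁻ (is-z u) u∈) (sym (does⁻ (is-z v) v∈)))) ε }
    ; z∈ = does⁺ (is-z z) refl
    ; w∉ = λ w∈ → z≢w (sym (does⁻ (is-z w) w∈))
    }

  ∈-trivialArm : ∀ v → v ∈ⱽ Arm.sub trivialArm → v ≡ z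
  ∈-trivialArm v = does⁻ (is-z v)

  trivialArm-invariant : ∀ π → ⟦ π ⟧ z ≡ z → MapsOnto π (Arm.sub trivialArm) (Arm.sub trivialArm)
  trivialArm-invariant π fix =
      (λ v → does-⇔ (mk⇔ (λ eq → Injection.injective (↔⇒↣ (Iso.bij π)) (trans eq (sym fix)))
                          (λ { refl → fix })) (is-z (⟦ π ⟧ v)) (is-z v))
    , λ _ _ → refl

  fill : Maybe (Arm G z w) → Arm G z w
  fill (just A) = A
  fill nothing  = trivialArm

  fill-All : ∀ {P : Arm G z w → Set} {A} → All P A → P trivialArm → P (fill A)
  fill-All (just p) _ = p
  fill-All nothing  p = p

D₁≡k*rigidCount : ∀ X (S : Subgraph (body X)) (r : V ⌊ S ⌋) → tag X (proj₁ r) ≢ nothing →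
                  (∀ v → v ∈ⱽ S → tag X v ≢ nothing → v ≡ proj₁ r) →
                  ∀ k → D₁ ⌊ S ⌋ k r ≡ k * rigidCount (restrict X S) k
D₁≡k*rigidCount X S r r-tagged only k = trans
  (D≡k^n*rigidCount (restrict X S) k {1} (λ _ → r) (λ { {zero} {zero} _ → refl })
    (λ _ → r-tagged)
    (λ { (v , v∈) some → zero , sym (Σ-T-≡ (inV S) (only v v∈ some)) })
    (Stab₁ ⌊ S ⌋ r) (λ π fix _ → fix) (λ π fix → fix zero))
  (cong (_* rigidCount (restrict X S) k) (*-identityʳ k))

-- With no untagged vertex, all labelings are related and every tag-preserving automorphism is the
-- identity. A nonzero `k` provides a labeling to represent the class.
rigidCount-allRoots : ∀ (X : Tagged) k .{{_ : NonZero k}} → (∀ v → tag X v ≢ nothing) → rigidCount X k ≡ 1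
rigidCount-allRoots X k@(suc _) all = enumeration-unique (rigid-enumeration X k)
  (one-class ((λ _ → zero) , λ π _ v → fixes-roots X (iso π) (tag-iso π) v (all v))
             (λ { (φ , _) (ψ , _) → labelId {φ = φ} {ψ} λ v none → contradiction none (all v) }))

/-exact : ∀ {d} n .{{_ : NonZero n}} r → d ≡ n * r → d / n ≡ r
/-exact n r eq = trans (cong (_/ n) (trans eq (*-comm n r))) (m*n/n≡m r n)

-- The decomposed graph as a gluing

module Decomposed
  (G : Graph) (x y : V G) (x≢y : x ≢ y) {m : ℕ} (𝒫 : Pieces G x y m) (𝒟 : IsDecomposition 𝒫)
  {g : ℕ} (𝒞 : Classes 𝒫 g) (k : ℕ) .{{_ : NonZero k}} where

  open Pieces 𝒫 hiding (Aˣ; Aʸ)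
  open IsDecomposition 𝒟
  open Classes 𝒞 hiding (model; multiplicity)

  𝔾 : Tagged
  𝔾 = twoRoots G x y

  armX : Arm G x y
  armX = fill G x y x≢y (Aˣ 𝒫)

  armY : Arm G y x
  armY = fill G y x (x≢y ∘ sym) (Aʸ 𝒫)

  piece : Fin (2 + m) → Subgraph G
  piece zero          = Arm.sub armX
  piece (suc zero)    = Arm.sub armY
  piece (suc (suc j)) = Hs j

  -- Each arm has a class of its own, so it is never compared with another piece and can serve as
  -- its own model.
  pieceClass : Fin (2 + m) → Fin (2 + g)
  pieceClass zero          = zero
  pieceClass (suc zero)    = suc zero
  pieceClass (suc (suc j)) = suc (suc (class j))

  modelOf : Fin g → Tagged
  modelOf i = twoRoots (graph (model 𝒞 i)) (rootˣ (model 𝒞 i)) (rootʸ (model 𝒞 i))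

  pieceModel : Fin (2 + g) → Tagged
  pieceModel zero          = restrict 𝔾 (Arm.sub armX)
  pieceModel (suc zero)    = restrict 𝔾 (Arm.sub armY)
  pieceModel (suc (suc i)) = modelOf i

  partPiece : Part m → Fin (2 + m)
  partPiece (link j) = suc (suc j)
  partPiece armˣ     = zero
  partPiece armʸ     = suc zero

  vertex-piece : ∀ p {v} → VertexOf p v → v ∈ⱽ piece (partPiece p)
  vertex-piece (link j) (just v∈) = v∈
  vertex-piece armˣ v∈ with Aˣ 𝒫 | v∈
  ... | just _ | just v∈ = v∈
  vertex-piece armʸ v∈ with Aʸ 𝒫 | v∈
  ... | just _ | just v∈ = v∈

  edge-piece : ∀ p {u v} → EdgeOf p u v → T (inE (piece (partPiece p)) u v)
  edge-piece (link j) (just e) = e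
  edge-piece armˣ e with Aˣ 𝒫 | e
  ... | just _ | just e = e
  edge-piece armʸ e with Aʸ 𝒫 | e
  ... | just _ | just e = e

  armX∩H : ∀ j v → v ∈ⱽ Arm.sub armX → v ∈ⱽ Hs j → v ≡ x
  armX∩H = fill-All G x y x≢y {P = λ A → ∀ j v → v ∈ⱽ Arm.sub A → v ∈ⱽ Hs j → v ≡ x} Aˣ∩H
    λ _ v v∈ _ → ∈-trivialArm G x y x≢y v v∈

  armY∩H : ∀ j v → v ∈ⱽ Arm.sub armY → v ∈ⱽ Hs j → v ≡ y
  armY∩H = fill-All G y x (x≢y ∘ sym) {P = λ A → ∀ j v → v ∈ⱽ Arm.sub A → v ∈ⱽ Hs j → v ≡ y} Aʸ∩H
    λ _ v v∈ _ → ∈-trivialArm G y x (x≢y ∘ sym) v v∈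

  armX∩armY : ∀ v → v ∈ⱽ Arm.sub armX → ¬ (v ∈ⱽ Arm.sub armY)
  armX∩armY v v∈X v∈Y = fill-All G x y x≢y {P = λ A → v ∈ⱽ Arm.sub A → ⊥}
    (map-All
      (λ {A} disjoint v∈A → fill-All G y x (x≢y ∘ sym) {P = λ B → v ∈ⱽ Arm.sub B → ⊥}
        (map-All (λ d v∈B → d v v∈A v∈B) disjoint)
        (λ v∈B → Arm.w∉ A (subst (_∈ⱽ Arm.sub A) (∈-trivialArm G y x (x≢y ∘ sym) v v∈B) v∈A)) v∈Y)
      Aˣ∩Aʸ)
    (λ v∈A → Arm.w∉ armY (subst (_∈ⱽ Arm.sub armY) (∈-trivialArm G x y x≢y v v∈A) v∈Y)) v∈X

  rootX : ∀ {v} → v ≡ x → tag 𝔾 v ≢ nothing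
  rootX refl = tag₂-a G x y

  rootY : ∀ {v} → v ≡ y → tag 𝔾 v ≢ nothing
  rootY refl = tag₂-b G x y

  meet : ∀ j l {v} → v ∈ⱽ piece j → v ∈ⱽ piece l → j ≢ l → tag 𝔾 v ≢ nothing
  meet zero          zero          v∈ v∈′ j≢l = contradiction refl j≢l
  meet zero          (suc zero)    v∈ v∈′ _   = ⊥-elim (armX∩armY _ v∈ v∈′)
  meet zero          (suc (suc l)) v∈ v∈′ _   = rootX (armX∩H l _ v∈ v∈′)
  meet (suc zero)    zero          v∈ v∈′ _   = ⊥-elim (armX∩armY _ v∈′ v∈)
  meet (suc zero)    (suc zero)    v∈ v∈′ j≢l = contradiction refl j≢l
  meet (suc zero)    (suc (suc l)) v∈ v∈′ _   = rootY (armY∩H l _ v∈ v∈′)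
  meet (suc (suc j)) zero          v∈ v∈′ _   = rootX (armX∩H j _ v∈′ v∈)
  meet (suc (suc j)) (suc zero)    v∈ v∈′ _   = rootY (armY∩H j _ v∈′ v∈)
  meet (suc (suc j)) (suc (suc l)) v∈ v∈′ j≢l
    with H∩H j l (j≢l ∘ cong (λ t → suc (suc t))) _ v∈ v∈′
  ... | inj₁ eq = rootX eq
  ... | inj₂ eq = rootY eq

  distinct : ∀ j l → j ≢ l → pieceClass j ≡ pieceClass l → ¬ SameSubgraph (piece j) (piece l)
  distinct zero          zero          j≢l _  _ = j≢l refl
  distinct (suc zero)    (suc zero)    j≢l _  _ = j≢l refl
  distinct (suc (suc j)) (suc (suc l)) j≢l _    = H-distinct j l (j≢l ∘ cong (λ t → suc (suc t)))
  distinct zero          (suc zero)    _   ()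
  distinct zero          (suc (suc _)) _   ()
  distinct (suc zero)    zero          _   ()
  distinct (suc (suc _)) zero          _   ()
  distinct (suc zero)    (suc (suc _)) _   ()
  distinct (suc (suc _)) (suc zero)    _   ()

  module _ (π : TaggedIso 𝔾 𝔾) where

    fixX : ⟪ π ⟫ x ≡ x
    fixX = fixes-roots 𝔾 (iso π) (tag-iso π) x (rootX refl)

    fixY : ⟪ π ⟫ y ≡ y
    fixY = fixes-roots 𝔾 (iso π) (tag-iso π) y (rootY refl)

    σ : Fin m ↔ Fin m
    σ = proj₁ (H-permuted (iso π) (fixX , fixY))

    onto : ∀ j → MapsOnto (iso π) (Hs j) (Hs (to σ j))
    onto = proj₂ (H-permuted (iso π) (fixX , fixY))

    class-preserved : ∀ j → class (to σ j) ≡ class j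
    class-preserved j = sym (Equivalence.from (class-≡ j (to σ j))
      (iso (restrictIso (Hs j) (Hs (to σ j)) π (onto j))
      , Σ-T-≡ (inV (Hs (to σ j))) fixX , Σ-T-≡ (inV (Hs (to σ j))) fixY))

    onto-pieces : ∀ j → MapsOnto (iso π) (piece j) (piece (to (lift₀ (lift₀ σ)) j))
                      × pieceClass (to (lift₀ (lift₀ σ)) j) ≡ pieceClass j
    onto-pieces zero = fill-All G x y x≢y {P = λ A → MapsOnto (iso π) (Arm.sub A) (Arm.sub A)}
      (Aˣ-invariant (iso π) (fixX , fixY)) (trivialArm-invariant G x y x≢y (iso π) fixX) , refl
    onto-pieces (suc zero) = fill-All G y x (x≢y ∘ sym) {P = λ A → MapsOnto (iso π) (Arm.sub A) (Arm.sub A)}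
      (Aʸ-invariant (iso π) (fixX , fixY)) (trivialArm-invariant G y x (x≢y ∘ sym) (iso π) fixY) , refl
    onto-pieces (suc (suc j)) = onto j , cong (λ t → suc (suc t)) (class-preserved j)

  gluing : Gluing 𝔾 piece pieceClass pieceModel
  gluing = record
    { cover-V  = λ v → let p , v∈ = cover-V v in partPiece p , vertex-piece p v∈
    ; cover-E  = λ u v e → let p , e∈ = cover-E u v e in partPiece p , edge-piece p e∈
    ; meet     = λ {j} {l} → meet j l
    ; distinct = λ {j} {l} → distinct j l
    ; permuted = λ π → lift₀ (lift₀ (σ π)) , onto-pieces π
    ; chart    = λ { zero → taggedId ; (suc zero) → taggedId
                   ; (suc (suc j)) → rootedIso⇒taggedIso (H j) (model 𝒞 (class j)) (H≅model j) }
    }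

  -- Multiplicity 1 turns the binomial of an arm into `r C 1 = r`, which is its factor `α`.
  pieceMultiplicity : Fin (2 + g) → ℕ
  pieceMultiplicity zero          = 1
  pieceMultiplicity (suc zero)    = 1
  pieceMultiplicity (suc (suc i)) = multiplicity 𝒞 i

  fibres : ∀ i → Enumeration {Σ (Fin (2 + m)) λ j → pieceClass j ≡ i} (_≡_ on proj₁) (pieceMultiplicity i)
  fibres zero = one-class (zero , refl)
    λ { (zero , _) (zero , _) → refl ; (suc zero , ()) _ ; (suc (suc _) , ()) _
      ; _ (suc zero , ()) ; _ (suc (suc _) , ()) }
  fibres (suc zero) = one-class (suc zero , refl)
    λ { (suc zero , _) (suc zero , _) → refl ; (zero , ()) _ ; (suc (suc _) , ()) _
      ; _ (zero , ()) ; _ (suc (suc _) , ()) }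
  fibres (suc (suc i)) = pullback {_≈′_ = _≡_ on proj₁}
    (λ { (suc (suc j) , eq) → j , suc-injective (suc-injective eq) ; (zero , ()) ; (suc zero , ()) })
    (λ { {suc (suc _) , _} {suc (suc _) , _} eq → suc-injective (suc-injective eq)
       ; {zero , ()} ; {suc zero , ()} ; {_} {zero , ()} ; {_} {suc zero , ()} })
    (λ { {suc (suc _) , _} {suc (suc _) , _} eq → cong (λ t → suc (suc t)) eq
       ; {zero , ()} ; {suc zero , ()} ; {_} {zero , ()} ; {_} {suc zero , ()} })
    (λ { (j , eq) → (suc (suc j) , cong (λ t → suc (suc t)) eq) , refl })
    (filter-enumeration λ j → class j ≟ᶠ i)

  onlyX : (A : Arm G x y) → ∀ v → v ∈ⱽ Arm.sub A → tag 𝔾 v ≢ nothing → v ≡ x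
  onlyX A v v∈ some with tag₂-root G x y v some
  ... | inj₁ eq = eq
  ... | inj₂ refl = ⊥-elim (Arm.w∉ A v∈)

  onlyY : (A : Arm G y x) → ∀ v → v ∈ⱽ Arm.sub A → tag 𝔾 v ≢ nothing → v ≡ y
  onlyY A v v∈ some with tag₂-root G x y v some
  ... | inj₁ refl = ⊥-elim (Arm.w∉ A v∈)
  ... | inj₂ eq = eq

  D-armX : (A : Arm G x y) → D-arm A k ≡ k * rigidCount (restrict 𝔾 (Arm.sub A)) k
  D-armX A = D₁≡k*rigidCount 𝔾 (Arm.sub A) (Arm.root A) (rootX refl) (onlyX A) k

  D-armY : (A : Arm G y x) → D-arm A k ≡ k * rigidCount (restrict 𝔾 (Arm.sub A)) k
  D-armY A = D₁≡k*rigidCount 𝔾 (Arm.sub A) (Arm.root A) (rootY refl) (onlyY A) k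

  αX : α (Aˣ 𝒫) k ≡ rigidCount (restrict 𝔾 (Arm.sub armX)) k
  αX with Aˣ 𝒫
  ... | just A  = /-exact k _ (D-armX A)
  ... | nothing = sym (rigidCount-allRoots (restrict 𝔾 (Arm.sub (trivialArm G x y x≢y))) k
                    λ { (v , v∈) → rootX (∈-trivialArm G x y x≢y v v∈) })

  αY : α (Aʸ 𝒫) k ≡ rigidCount (restrict 𝔾 (Arm.sub armY)) k
  αY with Aʸ 𝒫
  ... | just A  = /-exact k _ (D-armY A)
  ... | nothing = sym (rigidCount-allRoots (restrict 𝔾 (Arm.sub (trivialArm G y x (x≢y ∘ sym)))) k
                    λ { (v , v∈) → rootY (∈-trivialArm G y x (x≢y ∘ sym) v v∈) })

  -- Class `i` has a member `H j`, and its isomorphism with the model would identify `x` with `y` if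
  -- the roots of the model coincided.
  model-roots-distinct : ∀ i → rootˣ (model 𝒞 i) ≢ rootʸ (model 𝒞 i)
  model-roots-distinct i eq with nonempty i
  ... | j , refl with H≅model j
  ...   | f , fx , fy = x≢y (cong proj₁ (Injection.injective (↔⇒↣ (Iso.bij f)) (trans fx (trans eq (sym fy)))))

  D-model : ∀ i → D-rooted (model 𝒞 i) k ≡ k ^ 2 * rigidCount (modelOf i) k
  D-model i = D₂≡k²*rigidCount (graph (model 𝒞 i)) _ _ (model-roots-distinct i) k

  D-model/k² : ∀ i → (D-rooted (model 𝒞 i) k / k ²) ≡ rigidCount (modelOf i) k
  D-model/k² i = /-exact (k ^ 2) {{m^n≢0 k 2}} (rigidCount (modelOf i) k) (D-model i)

  D-formula : D₂ G k x y ≡ k ^ 2 * α (Aˣ 𝒫) k * α (Aʸ 𝒫) k *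
              product (tabulate λ i → (D-rooted (model 𝒞 i) k / k ²) C multiplicity 𝒞 i)
  D-formula = begin
    D₂ G k x y
      ≡⟨ D₂≡k²*rigidCount G x y x≢y k ⟩
    k ^ 2 * rigidCount 𝔾 k
      ≡⟨ cong (k ^ 2 *_) (rigidCount-gluing gluing fibres) ⟩
    k ^ 2 * ((rX C 1) * ((rY C 1) * product (tabulate λ i → rigidCount (modelOf i) k C multiplicity 𝒞 i)))
      ≡⟨ cong (k ^ 2 *_) (cong₂ _*_ (trans (nC1≡n rX) (sym αX)) (cong₂ _*_ (trans (nC1≡n rY) (sym αY))
           (cong product (list-tabulate-cong λ i → cong (_C multiplicity 𝒞 i) (sym (D-model/k² i)))))) ⟩
    k ^ 2 * (α (Aˣ 𝒫) k * (α (Aʸ 𝒫) k * ∏))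
      ≡⟨ *-assoc (k ^ 2) (α (Aˣ 𝒫) k) (α (Aʸ 𝒫) k * ∏) ⟨
    k ^ 2 * α (Aˣ 𝒫) k * (α (Aʸ 𝒫) k * ∏)
      ≡⟨ *-assoc (k ^ 2 * α (Aˣ 𝒫) k) (α (Aʸ 𝒫) k) ∏ ⟨
    k ^ 2 * α (Aˣ 𝒫) k * α (Aʸ 𝒫) k * ∏ ∎
    where
    open ≡-Reasoning
    rX rY ∏ : ℕ
    rX = rigidCount (restrict 𝔾 (Arm.sub armX)) k
    rY = rigidCount (restrict 𝔾 (Arm.sub armY)) k
    ∏  = product (tabulate λ i → (D-rooted (model 𝒞 i) k / k ²) C multiplicity 𝒞 i)

theorem7 : (G : Graph) (x y : V G) → x ≢ y →
    (m : ℕ) → 1 ≤ m → (𝒫 : Pieces G x y m) → IsDecomposition 𝒫 →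
    (g : ℕ) (𝒞 : Classes 𝒫 g) →
    (k : ℕ) .{{_ : NonZero k}} →
    (∀ i → k ^ 2 ∣ D-rooted (model 𝒞 i) k) ×
    All (λ A → k ∣ D-arm A k) (Aˣ 𝒫) ×
    All (λ A → k ∣ D-arm A k) (Aʸ 𝒫) ×
    D₂ G k x y ≡ k ^ 2 * α (Aˣ 𝒫) k * α (Aʸ 𝒫) k * product (tabulate λ i → (D-rooted (model 𝒞 i) k / k ²) C multiplicity 𝒞 i)
theorem7 G x y x≢y m _ 𝒫 𝒟 g 𝒞 k =
    -- The factorizations behind the formula also give the divisibilities, so every `_/_` in it is
    -- exact.
    (λ i → multiple (D-model i))
  , everywhere (λ A → multiple (D-armX A)) (Aˣ 𝒫)
  , everywhere (λ A → multiple (D-armY A)) (Aʸ 𝒫)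
  , D-formula
  where
  open Decomposed G x y x≢y 𝒫 𝒟 𝒞 k
  multiple : ∀ {d n r} → d ≡ n * r → n ∣ d
  multiple {n = n} {r} refl = m∣m*n r
  everywhere : {A : Set} {P : A → Set} → (∀ a → P a) → ∀ a? → All P a?
  everywhere p (just a) = just (p a)
  everywhere p nothing  = nothing
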